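{- For every restricted frame graph $H$ that is also a $\ge 2$-subdivision of some multigraph, there is a set $\mathcal S$ of stable sets of $H$ such that the graph-stable set pair $(H,\mathcal S)$ is constructible.
   Context: A $\ge 2$-subdivision of a multigraph is obtained by replacing every edge by a path with at least $3$ edges. A frame is the boundary of an axis-parallel box $[a,b]\times[c,d]\subset\mathbb R^2$ ($a<b$, $c<d$). A graph $G$ is a restricted frame graph if there is a family $\{F_v\}$ of frames with $uv\in E(G)$ iff $F_u\cap F_v\neq\emptyset$ ($u\ne v$), such that: (1) no corner of a frame lies on another frame; (2) the left side of any frame meets no other frame; (3) if the right side of a frame meets a second frame, it meets both the top and bottom sides of the second frame; (4) if two frames intersect, no frame is entirely contained in the intersection of the closed regions bounded by them. A graph-stable set pair $(G,\mathcal S)$ is a graph $G$ with a set $\mathcal S$ of stable sets of $G$; $(G,\mathcal S)$ is an induced subgraph-stable set pair of $(H,\mathcal S')$ if $G$ is an induced subgraph of $H$ and $\mathcal S\subseteq\{S'\cap V(G): S'\in\mathcal S'\}$. The procedure $\mathrm{NEXT}(G,\mathcal S)=(G',\mathcal S')$: add, for each $S\in\mathcal S$, a disjoint copy $(H_S,\mathcal S(H_S))$ of $(G,\mathcal S)$; for each $S\in\mathcal S$ and $T\in\mathcal S(H_S)$ add a new vertex $v_{S,T}$ whose neighborhood is exactly $T$; and set $\mathcal S'=\{S\cup T: S\in\mathcal S, T\in\mathcal S(H_S)\}\cup\{S\cup\{v_{S,T}\}: S\in\mathcal S, T\in\mathcal S(H_S)\}$. A graph-stable set pair is constructible if it is an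 induced subgraph-stable set pair of $\mathrm{NEXT}^i(G_0,\mathcal S_0)$ for some $i\ge 0$, where $G_0=K_1$ and $\mathcal S_0=\{V(G_0)\}$.
   Formalization: The frames have rational rather than real corner coordinates, and points of the plane are rational; graphs are finite and multigraphs have parallel edges but no loops. -}

module Defs where

open import Level using (0ℓ)
open import Data.Nat using (ℕ; zero; suc; _∸_; _≤_)
open import Data.Fin using (Fin; toℕ)
open import Data.Bool using (Bool; true; false)
open import Data.Unit using (⊤; tt)
open import Data.Empty using (⊥)
open import Data.Sum using (_⊎_; inj₁; inj₂)
open import Data.Product using (Σ; ∃; ∃-syntax; _×_; _,_; proj₁; proj₂)
open import Data.Rational using (ℚ) renaming (_≤_ to _≤ℚ_; _<_ to _<ℚ_)
open import Relation.Nullary using (¬_)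
open import Relation.Binary.PropositionalEquality using (_≡_; _≢_)
open import Function.Bundles using (_⇔_; _↔_; Inverse; Equivalence)

record Graph : Set₁ where
  field
    V : Set
    E : V → V → Set

IsSimple : (n : ℕ) → (Fin n → Fin n → Set) → Set
IsSimple n E = (∀ u v → E u v → E v u) × (∀ u → ¬ E u u)

record Frame : Set where
  field
    a b c d : ℚ
    a<b : a <ℚ b
    c<d : c <ℚ d

Point : Set
Point = ℚ × ℚ

module _ (F : Frame) where
  open Frame F

  LeftSide RightSide TopSide BottomSide OnFrame InRegion Corner : Point → Set
  LeftSide   (x , y) = x ≡ a × c ≤ℚ y × y ≤ℚ d
  RightSide  (x , y) = x ≡ b × c ≤ℚ y × y ≤ℚ d
  BottomSide (x , y) = y ≡ c × a ≤ℚ x × x ≤ℚ b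
  TopSide    (x , y) = y ≡ d × a ≤ℚ x × x ≤ℚ b
  OnFrame p = (LeftSide p ⊎ RightSide p) ⊎ (BottomSide p ⊎ TopSide p)
  InRegion   (x , y) = (a ≤ℚ x × x ≤ℚ b) × (c ≤ℚ y × y ≤ℚ d)
  Corner     (x , y) = (x ≡ a ⊎ x ≡ b) × (y ≡ c ⊎ y ≡ d)

Meets : (Point → Set) → (Point → Set) → Set
Meets A B = ∃[ p ] (A p × B p)

record IsRestrictedFrameRep (n : ℕ) (E : Fin n → Fin n → Set)
                            (F : Fin n → Frame) : Set where
  field
    represents : ∀ u v → u ≢ v → E u v ⇔ Meets (OnFrame (F u)) (OnFrame (F v))
    cond1 : ∀ u v → u ≢ v → ∀ p → Corner (F u) p → ¬ OnFrame (F v) p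
    cond2 : ∀ u v → u ≢ v → ¬ Meets (LeftSide (F u)) (OnFrame (F v))
    cond3 : ∀ u v → u ≢ v → Meets (RightSide (F u)) (OnFrame (F v)) →
            Meets (RightSide (F u)) (TopSide (F v)) ×
            Meets (RightSide (F u)) (BottomSide (F v))
    cond4 : ∀ u v → u ≢ v → Meets (OnFrame (F u)) (OnFrame (F v)) →
            ∀ w → ¬ (∀ p → OnFrame (F w) p → InRegion (F u) p × InRegion (F v) p)

RestrictedFrameGraph : (n : ℕ) → (Fin n → Fin n → Set) → Set
RestrictedFrameGraph n E = ∃[ F ] IsRestrictedFrameRep n E F

record Multigraph : Set where
  field
    m k  : ℕ
    ends : Fin k → Fin m × Fin m
    loopless : ∀ e → proj₁ (ends e) ≢ proj₂ (ends e)

module _ (M : Multigraph) (len : Fin (Multigraph.k M) → ℕ) where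
  open Multigraph M

  -- branch vertices, and internal vertices (e , i), i = 0 .. len e - 2,
  -- of the path of length len e replacing edge e
  SubV : Set
  SubV = Fin m ⊎ Σ (Fin k) (λ e → Fin (len e ∸ 1))

  data SubAdj : SubV → SubV → Set where
    first : ∀ e (i : Fin (len e ∸ 1)) → toℕ i ≡ 0 →
            SubAdj (inj₁ (proj₁ (ends e))) (inj₂ (e , i))
    step  : ∀ e (i j : Fin (len e ∸ 1)) → suc (toℕ i) ≡ toℕ j →
            SubAdj (inj₂ (e , i)) (inj₂ (e , j))
    last  : ∀ e (i : Fin (len e ∸ 1)) → suc (toℕ i) ≡ len e ∸ 1 →
            SubAdj (inj₂ (e , i)) (inj₁ (proj₂ (ends e)))

  SubE : SubV → SubV → Set
  SubE x y = SubAdj x y ⊎ SubAdj y x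

IsGe2Subdivision : (n : ℕ) → (Fin n → Fin n → Set) → Set
IsGe2Subdivision n E =
  Σ Multigraph λ M → Σ (Fin (Multigraph.k M) → ℕ) λ len →
    (∀ e → 3 ≤ len e) ×
    Σ (Fin n ↔ SubV M len) λ φ →
      ∀ u v → E u v ⇔ SubE M len (Inverse.to φ u) (Inverse.to φ v)

record GSP : Set₁ where
  field
    V : Set
    E : V → V → Set
    I : Set
    S : I → V → Set

AllStable : (V : Set) (E : V → V → Set) (I : Set) (S : I → V → Set) → Set
AllStable V E I S = ∀ i u v → S i u → S i v → ¬ E u v

InducedPair : GSP → GSP → Set
InducedPair P Q =
  Σ (P.V → Q.V) λ f →
    (∀ x y → f x ≡ f y → x ≡ y) ×
    (∀ x y → P.E x y ⇔ Q.E (f x) (f y)) ×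
    (∀ i → ∃[ j ] (∀ x → P.S i x ⇔ Q.S j (f x)))
  where
    module P = GSP P
    module Q = GSP Q

module _ (P : GSP) where
  open GSP P

  -- old vertices, copies (S , v) of v in H_S, new vertices v_{S,T}
  data NV : Set where
    old  : V → NV
    copy : I → V → NV
    new  : I → I → NV

  data NE : NV → NV → Set where
    oldE  : ∀ {u v} → E u v → NE (old u) (old v)
    copyE : ∀ s {u v} → E u v → NE (copy s u) (copy s v)
    newE₁ : ∀ s t u → S t u → NE (new s t) (copy s u)
    newE₂ : ∀ s t u → S t u → NE (copy s u) (new s t)

  -- index (s , t , false) ↦ S ∪ T ;  (s , t , true) ↦ S ∪ {v_{S,T}}
  data NS : I × I × Bool → NV → Set where
    inS₀  : ∀ s t u → S s u → NS (s , t , false) (old u)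
    inT   : ∀ s t u → S t u → NS (s , t , false) (copy s u)
    inS₁  : ∀ s t u → S s u → NS (s , t , true) (old u)
    inNew : ∀ s t → NS (s , t , true) (new s t)

NEXT : GSP → GSP
NEXT P = record { V = NV P ; E = NE P ; I = GSP.I P × GSP.I P × Bool ; S = NS P }

K1 : GSP
K1 = record { V = ⊤ ; E = λ _ _ → ⊥ ; I = ⊤ ; S = λ _ _ → ⊤ }

NEXT^ : ℕ → GSP
NEXT^ zero    = K1
NEXT^ (suc i) = NEXT (NEXT^ i)

Constructible : GSP → Set
Constructible P = ∃[ i ] InducedPair P (NEXT^ i)

mkGSP : (V : Set) → (V → V → Set) → (I : Set) → (I → V → Set) → GSP
mkGSP V E I S = record { V = V ; E = E ; I = I ; S = S }

{-# OPTIONS --safe #-}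
module Submission where

-- The set of stable sets may be empty, so it suffices to embed H into some NEXT^ i.
-- Two frames that are not disjoint are either nested (x ≺ z: x lies inside z) or one sticks
-- out of the right side of the other (x ↷ y: the left side of x is inside y). The embedding
-- works as soon as no triple is bad, i.e. satisfies x ≺ z, x ↷ y and z ↷ y: peel off an
-- outermost frame s out of which nothing sticks; what lies inside s is then a union of
-- components of H − s, and the out-neighbours of s form a chain that is the trace of some
-- stable set.
-- Bad triples are removed one by one, changing the relations but not H. If y has only the
-- neighbours x and z, reverse its edges. Otherwise y is a branch vertex, so z and its
-- neighbours are internal vertices of subdivided edges; reversing suitable edges at
-- neighbours of y then detaches from z everything inside it, and this is moved into y.

open import Defs
open import Data.Bool using (true; false)
open import Data.Empty using (⊥; ⊥-elim)
open import Data.Fin using (Fin; toℕ)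
open import Data.Fin.Induction using (spo-wellFounded; spo-noetherian)
open import Data.Fin.Properties using (_≟_; any?; toℕ-injective; toℕ<n)
open import Data.List using (List; []; _∷_; length; filter; allFin; cartesianProduct)
open import Data.List.Membership.Propositional using (_∈_; lose; find)
open import Data.List.Membership.Propositional.Properties
  using (∈-filter⁺; ∈-filter⁻; ∈-allFin; ∈-cartesianProduct⁺)
open import Data.List.Properties using (filter-notAll)
import Data.List.Relation.Unary.Any as Any
open import Data.List.Relation.Unary.Any using (here)
open import Data.Nat using (ℕ; zero; suc; _∸_; _≤_)
import Data.Nat.Properties as ℕ
open import Data.Product using (Σ; ∃; ∃-syntax; _×_; _,_; proj₁; proj₂)
open import Data.Product.Properties using (≡-dec)
open import Data.Rational using (ℚ) renaming (_≤_ to _≤ℚ_; _<_ to _<ℚ_)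
import Data.Rational.Properties as ℚ
open import Data.Sum using (_⊎_; inj₁; inj₂; [_,_]′)
import Data.Sum as Sum
open import Data.Unit using (tt)
open import Function using (_∘_; flip; mk⇔)
open import Function.Bundles using (_⇔_; Inverse; Equivalence)
open import Induction.WellFounded using (Acc; acc; WellFounded; wf⇒asym)
import Induction.WellFounded as WF
open import Relation.Binary using (Decidable; Tri; tri<; tri≈; tri>)
open import Relation.Binary.PropositionalEquality
  using (_≡_; _≢_; refl; sym; trans; cong; subst; subst₂; resp₂; isEquivalence; ≢-sym)
open import Relation.Nullary using (¬_; Dec; yes; no; contradiction)
open import Relation.Nullary.Decidable using (_×-dec_; _⊎-dec_; ¬?)

-- Nesting relations on the vertices, abstracted from the geometry of frames.

-- x ≺ y: the frame x lies inside y; x ↷ y: x sticks out of the right side of y,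
-- its left side being inside y.
record Nesting {n : ℕ} (E : Fin n → Fin n → Set) : Set₁ where
  infix 4 _≺_ _↷_
  field
    _≺_ _↷_    : Fin n → Fin n → Set
    _≺?_       : Decidable _≺_
    _↷?_       : Decidable _↷_
    ≺-trans    : ∀ {x y z} → x ≺ y → y ≺ z → x ≺ z
    ≺-irrefl   : ∀ {x} → ¬ x ≺ x
    ↷-wf       : WellFounded _↷_
    ≺⇒¬↷       : ∀ {x y} → x ≺ y → ¬ x ↷ y
    ≺⇒¬↶       : ∀ {x y} → x ≺ y → ¬ y ↷ x
    ≺-chain    : ∀ {x y z} → x ≺ y → x ≺ z → y ≡ z ⊎ (y ≺ z ⊎ z ≺ y)
    ↷-chain    : ∀ {x y z} → x ↷ y → x ↷ z → y ≡ z ⊎ (y ≺ z ⊎ z ≺ y)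
    ↷-inside   : ∀ {x y z} → x ↷ y → x ≺ z → y ≺ z ⊎ z ↷ y
    ↷-outward  : ∀ {x y z} → x ↷ y → y ≺ z → x ↷ z ⊎ x ≺ z
    ↷-hollow   : ∀ {x y w} → x ↷ y → w ≺ x → ¬ w ≺ y
    edge⇒↷     : ∀ {x y} → E x y → x ↷ y ⊎ y ↷ x
    ↷⇒edge     : ∀ {x y} → x ↷ y → E x y

  ↷-asym : ∀ {x y} → x ↷ y → ¬ y ↷ x
  ↷-asym = wf⇒asym ↷-wf

  Bad : Fin n × Fin n × Fin n → Set
  Bad (x , z , y) = x ≺ z × x ↷ y × z ↷ y

  bad? : ∀ τ → Dec (Bad τ)
  bad? (x , z , y) = (x ≺? z) ×-dec ((x ↷? y) ×-dec (z ↷? y))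

-- `Branch` marks the vertices of the multigraph before subdivision. By the last two fields,
-- distinct branch vertices are at distance at least three.
record SubdivisionLike {n : ℕ} (E : Fin n → Fin n → Set) : Set₁ where
  field
    E-sym           : ∀ {u v} → E u v → E v u
    E-irrefl        : ∀ {u} → ¬ E u u
    triangle-free   : ∀ {u v w} → E u v → E v w → ¬ E w u
    Branch          : Fin n → Set
    branch?         : ∀ v → Dec (Branch v)
    internal-degree : ∀ {v a b c} → ¬ Branch v → E v a → E v b → E v c →
                      a ≡ b ⊎ (a ≡ c ⊎ b ≡ c)
    branch-isolated : ∀ {u v} → Branch u → E u v → ¬ Branch v
    branch-unique   : ∀ {u v w} → Branch u → Branch w → E u v → E v w → u ≡ w

-- Removing a bad triple at a vertex of degree two by reversing its edges.

-- Makes y a source that sticks out of both x and z.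
module Flip {n : ℕ} {E : Fin n → Fin n → Set} (G : SubdivisionLike E) (S : Nesting E)
            {x y z : Fin n} (bad : Nesting.Bad S (x , z , y))
            (only : ∀ {b} → E y b → b ≡ x ⊎ b ≡ z) where
  open SubdivisionLike G
  open Nesting S

  private
    x≺z = proj₁ bad
    x↷y = proj₁ (proj₂ bad)
    z↷y = proj₂ (proj₂ bad)

    -- The flipped `y` crosses `x` and `z`, so the frames around it are those around `z`. Whatever
    -- lay inside `y` no longer does, and nothing sticks out of `y` any more.
    _≺′_ _↷′_ : Fin n → Fin n → Set
    a ≺′ b = (a ≡ y × z ≺ b) ⊎ ((a ≢ y × b ≢ y) × a ≺ b)
    a ↷′ b = (a ≡ y × E y b) ⊎ ((a ≢ y × b ≢ y) × a ↷ b)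

    z⊀y : ∀ {b} → z ≺ b → b ≢ y
    z⊀y p refl = ≺⇒¬↷ p z↷y

    Ey≢y : ∀ {b} → E y b → b ≢ y
    Ey≢y e refl = E-irrefl e

    wf′ : WellFounded _↷′_
    wf′ v = go (↷-wf v)
      where
      source : Acc _↷′_ y
      source = acc λ { (inj₁ (_ , e)) → ⊥-elim (E-irrefl e)
                     ; (inj₂ ((_ , q) , _)) → contradiction refl q }
      go : ∀ {v} → Acc _↷_ v → Acc _↷′_ v
      go (acc rs) = acc λ { (inj₁ (refl , _)) → source
                          ; (inj₂ (_ , p)) → go (rs p) }

    ends : ∀ {b} → b ≡ x ⊎ b ≡ z → E y b
    ends (inj₁ refl) = E-sym (↷⇒edge x↷y)
    ends (inj₂ refl) = E-sym (↷⇒edge z↷y)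

    y? : ∀ b → (y ≡ b) ⊎ (b ≢ y)
    y? b with b ≟ y
    ... | yes refl = inj₁ refl
    ... | no  q    = inj₂ q

    chain′ : ∀ {a b c} → a ≺′ b → a ≺′ c → b ≡ c ⊎ (b ≺′ c ⊎ c ≺′ b)
    chain′ (inj₁ (refl , p)) (inj₁ (_ , q)) =
      Sum.map₂ (Sum.map (λ r → inj₂ ((z⊀y p , z⊀y q) , r)) (λ r → inj₂ ((z⊀y q , z⊀y p) , r)))
               (≺-chain p q)
    chain′ (inj₁ (refl , p)) (inj₂ ((h , _) , q)) = contradiction refl h
    chain′ (inj₂ ((h , _) , q)) (inj₁ (refl , p)) = contradiction refl h
    chain′ (inj₂ ((_ , h) , p)) (inj₂ ((_ , k) , q)) =
      Sum.map₂ (Sum.map (λ r → inj₂ ((h , k) , r)) (λ r → inj₂ ((k , h) , r))) (≺-chain p q)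

    z≢y : z ≢ y
    z≢y refl = E-irrefl (↷⇒edge z↷y)

    x≢y : x ≢ y
    x≢y refl = E-irrefl (↷⇒edge x↷y)

    enters′ : ∀ {a b c} → a ↷′ b → a ↷′ c → b ≡ c ⊎ (b ≺′ c ⊎ c ≺′ b)
    enters′ (inj₁ (refl , e)) (inj₁ (_ , f)) with only e | only f
    ... | inj₁ refl | inj₁ refl = inj₁ refl
    ... | inj₁ refl | inj₂ refl = inj₂ (inj₁ (inj₂ ((x≢y , z≢y) , x≺z)))
    ... | inj₂ refl | inj₁ refl = inj₂ (inj₂ (inj₂ ((x≢y , z≢y) , x≺z)))
    ... | inj₂ refl | inj₂ refl = inj₁ refl
    enters′ (inj₁ (refl , p)) (inj₂ ((h , _) , q)) = contradiction refl h
    enters′ (inj₂ ((h , _) , q)) (inj₁ (refl , p)) = contradiction refl h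
    enters′ (inj₂ ((_ , h) , p)) (inj₂ ((_ , k) , q)) =
      Sum.map₂ (Sum.map (λ r → inj₂ ((h , k) , r)) (λ r → inj₂ ((k , h) , r))) (↷-chain p q)

    inside′ : ∀ {a b c} → a ↷′ b → a ≺′ c → b ≺′ c ⊎ c ↷′ b
    inside′ (inj₁ (refl , e)) (inj₁ (_ , p)) with only e
    ... | inj₁ refl = inj₁ (inj₂ ((x≢y , z⊀y p) , ≺-trans x≺z p))
    ... | inj₂ refl = inj₁ (inj₂ ((z≢y , z⊀y p) , p))
    inside′ (inj₁ (refl , p)) (inj₂ ((h , _) , q)) = contradiction refl h
    inside′ (inj₂ ((h , _) , q)) (inj₁ (refl , p)) = contradiction refl h
    inside′ (inj₂ ((_ , h) , p)) (inj₂ ((_ , k) , q)) =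
      Sum.map (λ r → inj₂ ((h , k) , r)) (λ r → inj₂ ((k , h) , r)) (↷-inside p q)

    -- No `c` lies strictly between `x` and `z`: it would contain `y`, and then so would `z`, or it
    -- would stick out of `y` and be a third neighbour of `y`.
    outward-x : ∀ {c} → x ≺ c → y ↷′ c ⊎ y ≺′ c
    outward-x p with ≺-chain p x≺z
    ... | inj₁ refl = inj₁ (inj₁ (refl , ends (inj₂ refl)))
    ... | inj₂ (inj₂ z≺c) = inj₂ (inj₁ (refl , z≺c))
    ... | inj₂ (inj₁ c≺z) with ↷-inside x↷y p
    ...   | inj₁ y≺c = contradiction z↷y (≺⇒¬↶ (≺-trans y≺c c≺z))
    ...   | inj₂ c↷y with only (E-sym (↷⇒edge c↷y))
    ...     | inj₁ refl = contradiction p ≺-irrefl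
    ...     | inj₂ refl = contradiction c≺z ≺-irrefl

    outward′ : ∀ {a b c} → a ↷′ b → b ≺′ c → a ↷′ c ⊎ a ≺′ c
    outward′ (inj₁ (refl , e)) (inj₁ (refl , _)) = ⊥-elim (E-irrefl e)
    outward′ (inj₁ (refl , e)) (inj₂ (_ , p)) with only e
    ... | inj₁ refl = outward-x p
    ... | inj₂ refl = inj₂ (inj₁ (refl , p))
    outward′ (inj₂ ((_ , h) , q)) (inj₁ (refl , p)) = contradiction refl h
    outward′ (inj₂ ((h , _) , p)) (inj₂ ((_ , k) , q)) =
      Sum.map (λ r → inj₂ ((h , k) , r)) (λ r → inj₂ ((h , k) , r)) (↷-outward p q)

    hollow′ : ∀ {a b w} → a ↷′ b → w ≺′ a → ¬ w ≺′ b
    hollow′ (inj₁ (refl , _)) (inj₁ (_ , p)) _ = z⊀y p refl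
    hollow′ (inj₁ (refl , _)) (inj₂ ((_ , h) , _)) _ = h refl
    hollow′ (inj₂ (_ , p)) (inj₁ (refl , q)) (inj₁ (_ , r)) = ↷-hollow p q r
    hollow′ (inj₂ (_ , p)) (inj₁ (refl , q)) (inj₂ ((h , _) , r)) = h refl
    hollow′ (inj₂ (_ , p)) (inj₂ ((h , _) , q)) (inj₁ (refl , r)) = h refl
    hollow′ (inj₂ (_ , p)) (inj₂ (_ , q)) (inj₂ (_ , r)) = ↷-hollow p q r

    ≺⇒¬↷′ : ∀ {a b} → a ≺′ b → ¬ a ↷′ b
    ≺⇒¬↷′ (inj₁ (refl , p)) (inj₁ (_ , e)) with only e
    ... | inj₁ refl = ≺-irrefl (≺-trans x≺z p)
    ... | inj₂ refl = ≺-irrefl p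
    ≺⇒¬↷′ (inj₁ (refl , p)) (inj₂ ((h , _) , q)) = h refl
    ≺⇒¬↷′ (inj₂ ((h , _) , q)) (inj₁ (refl , p)) = h refl
    ≺⇒¬↷′ (inj₂ (_ , p)) (inj₂ (_ , q)) = ≺⇒¬↷ p q

    ≺⇒¬↶′ : ∀ {a b} → a ≺′ b → ¬ b ↷′ a
    ≺⇒¬↶′ (inj₁ (refl , p)) (inj₁ (_ , e)) = E-irrefl e
    ≺⇒¬↶′ (inj₁ (refl , p)) (inj₂ ((_ , h) , q)) = h refl
    ≺⇒¬↶′ (inj₂ ((_ , h) , q)) (inj₁ (refl , p)) = h refl
    ≺⇒¬↶′ (inj₂ (_ , p)) (inj₂ (_ , q)) = ≺⇒¬↶ p q

    trans′ : ∀ {a b c} → a ≺′ b → b ≺′ c → a ≺′ c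
    trans′ (inj₁ (refl , p)) (inj₁ (refl , _)) = contradiction refl (z⊀y p)
    trans′ (inj₁ (refl , p)) (inj₂ (_ , q)) = inj₁ (refl , ≺-trans p q)
    trans′ (inj₂ ((_ , h) , _)) (inj₁ (refl , _)) = contradiction refl h
    trans′ (inj₂ ((h , _) , p)) (inj₂ ((_ , k) , q)) = inj₂ ((h , k) , ≺-trans p q)

    irrefl′ : ∀ {a} → ¬ a ≺′ a
    irrefl′ (inj₁ (refl , p)) = z⊀y p refl
    irrefl′ (inj₂ (_ , p)) = ≺-irrefl p

    edge′ : ∀ {a b} → E a b → a ↷′ b ⊎ b ↷′ a
    edge′ {a} {b} e with y? a | y? b
    ... | inj₁ refl | _ = inj₁ (inj₁ (refl , e))
    ... | inj₂ _ | inj₁ refl = inj₂ (inj₁ (refl , E-sym e))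
    ... | inj₂ h | inj₂ k =
      Sum.map (λ r → inj₂ ((h , k) , r)) (λ r → inj₂ ((k , h) , r)) (edge⇒↷ e)

    edge⁻′ : ∀ {a b} → a ↷′ b → E a b
    edge⁻′ (inj₁ (refl , e)) = e
    edge⁻′ (inj₂ (_ , p)) = ↷⇒edge p

    Ey? : ∀ b → Dec (E y b)
    Ey? b with b ≟ x | b ≟ z
    ... | yes p | _     = yes (ends (inj₁ p))
    ... | no  _ | yes p = yes (ends (inj₂ p))
    ... | no  p | no  q = no ([ p , q ]′ ∘ only)

  nesting : Nesting E
  nesting = record
    { _≺_ = _≺′_ ; _↷_ = _↷′_
    ; _≺?_ = λ a b → ((a ≟ y) ×-dec (z ≺? b)) ⊎-dec ((¬? (a ≟ y) ×-dec ¬? (b ≟ y)) ×-dec (a ≺? b))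
    ; _↷?_ = λ a b → ((a ≟ y) ×-dec Ey? b) ⊎-dec ((¬? (a ≟ y) ×-dec ¬? (b ≟ y)) ×-dec (a ↷? b))
    ; ≺-trans = trans′ ; ≺-irrefl = irrefl′ ; ↷-wf = wf′
    ; ≺⇒¬↷ = ≺⇒¬↷′ ; ≺⇒¬↶ = ≺⇒¬↶′
    ; ≺-chain = chain′ ; ↷-chain = enters′
    ; ↷-inside = inside′ ; ↷-outward = outward′ ; ↷-hollow = hollow′
    ; edge⇒↷ = edge′ ; ↷⇒edge = edge⁻′ }

  -- The flipped `y` can only be the innermost frame of a new bad triple. The middle frame then
  -- contains `z`, hence also `x`, and sticks out of neither.
  bad-preserved : ∀ τ → Nesting.Bad nesting τ → Bad τ
  bad-preserved _ (inj₁ (refl , p) , inj₁ (_ , e) , inj₁ (refl , _)) = contradiction refl (z⊀y p)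
  bad-preserved _ (inj₁ (refl , p) , inj₁ (_ , e) , inj₂ (_ , q)) with only e
  ... | inj₁ refl = contradiction q (≺⇒¬↶ (≺-trans x≺z p))
  ... | inj₂ refl = contradiction q (≺⇒¬↶ p)
  bad-preserved _ (inj₁ (refl , p) , inj₂ ((h , _) , _) , _) = contradiction refl h
  bad-preserved _ (inj₂ ((h , _) , p) , inj₁ (refl , _) , _) = contradiction refl h
  bad-preserved _ (inj₂ ((_ , h) , p) , _ , inj₁ (refl , _)) = contradiction refl h
  bad-preserved _ (inj₂ (_ , p) , inj₂ (_ , q) , inj₂ (_ , r)) = p , q , r

  removed : ¬ Nesting.Bad nesting (x , z , y)
  removed (_ , inj₁ (x≡y , _) , _) = x≢y x≡y
  removed (_ , inj₂ ((_ , h) , _) , _) = h refl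

-- Removing a bad triple by moving a part of the graph into `y`.

data Kind : Set where
  base kin src : Kind

-- The vertices of kind kin, which have no neighbour of kind base, are moved as a whole
-- into y, and those of kind src, all neighbours of y, become sources that stick out of y.
module Move {n : ℕ} {E : Fin n → Fin n → Set} (G : SubdivisionLike E) (S : Nesting E)
            (E? : Decidable E) (y : Fin n) (κ : Fin n → Kind)
            (κy : κ y ≡ base)
            (kin-base : ∀ {a b} → κ a ≡ kin → κ b ≡ base → ¬ E a b)
            (src-src : ∀ {a b} → κ a ≡ src → κ b ≡ src → ¬ E a b)
            (src-base : ∀ {a b} → κ a ≡ src → κ b ≡ base → E a b → b ≡ y)
            (src-y : ∀ {a} → κ a ≡ src → E a y)
            (src-kin : ∀ {a b c} → κ a ≡ src → κ b ≡ kin → κ c ≡ kin →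
                       E a b → E a c → b ≡ c)
            (src-kin-max : ∀ {a b c} → κ a ≡ src → κ b ≡ kin → κ c ≡ kin →
                           E a b → ¬ Nesting._≺_ S b c) where
  open SubdivisionLike G
  open Nesting S

  private
    -- The first two indices are the kinds of the two vertices, so that matching discards impossible
    -- combinations. A source contains nothing and shares with `y` the frames around it.
    data Inside : Kind → Kind → Fin n → Fin n → Set where
      bb  : ∀ {a b} → a ≺ b → Inside base base a b
      kk  : ∀ {a b} → a ≺ b → Inside kin kin a b
      kb₀ : ∀ {a} → Inside kin base a y
      kb  : ∀ {a b} → y ≺ b → Inside kin base a b
      sb  : ∀ {a b} → y ≺ b → Inside src base a b

    data Sticks : Kind → Kind → Fin n → Fin n → Set where
      bb : ∀ {a b} → a ↷ b → Sticks base base a b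
      kk : ∀ {a b} → a ↷ b → Sticks kin kin a b
      sb : ∀ {a} → Sticks src base a y
      sk : ∀ {a b} → E a b → Sticks src kin a b

    inside? : ∀ k l a b → Dec (Inside k l a b)
    inside? base base a b with a ≺? b
    ... | yes p = yes (bb p)
    ... | no ¬p = no λ { (bb p) → ¬p p }
    inside? base kin a b = no λ ()
    inside? base src a b = no λ ()
    inside? kin kin a b with a ≺? b
    ... | yes p = yes (kk p)
    ... | no ¬p = no λ { (kk p) → ¬p p }
    inside? kin base a b with y ≟ b | y ≺? b
    ... | yes refl | _ = yes kb₀
    ... | no _ | yes p = yes (kb p)
    ... | no q | no ¬p = no λ { (kb p) → ¬p p ; kb₀ → q refl }
    inside? kin src a b = no λ ()
    inside? src base a b with y ≺? b
    ... | yes p = yes (sb p)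
    ... | no ¬p = no λ { (sb p) → ¬p p }
    inside? src kin a b = no λ ()
    inside? src src a b = no λ ()

    sticks? : ∀ k l a b → Dec (Sticks k l a b)
    sticks? base base a b with a ↷? b
    ... | yes p = yes (bb p)
    ... | no ¬p = no λ { (bb p) → ¬p p }
    sticks? base kin a b = no λ ()
    sticks? base src a b = no λ ()
    sticks? kin kin a b with a ↷? b
    ... | yes p = yes (kk p)
    ... | no ¬p = no λ { (kk p) → ¬p p }
    sticks? kin base a b = no λ ()
    sticks? kin src a b = no λ ()
    sticks? src base a b with y ≟ b
    ... | yes refl = yes sb
    ... | no q = no λ { sb → q refl }
    sticks? src kin a b with E? a b
    ... | yes p = yes (sk p)
    ... | no ¬p = no λ { (sk p) → ¬p p }
    sticks? src src a b = no λ ()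

    trans′ : ∀ {k l m a b c} → Inside k l a b → Inside l m b c → Inside k m a c
    trans′ (bb p) (bb q) = bb (≺-trans p q)
    trans′ (kk p) (kk q) = kk (≺-trans p q)
    trans′ (kk p) kb₀    = kb₀
    trans′ (kk p) (kb q) = kb q
    trans′ kb₀    (bb q) = kb q
    trans′ (kb p) (bb q) = kb (≺-trans p q)
    trans′ (sb p) (bb q) = sb (≺-trans p q)

    irrefl′ : ∀ {k a} → ¬ Inside k k a a
    irrefl′ (bb p) = ≺-irrefl p
    irrefl′ (kk p) = ≺-irrefl p

    ≺⇒¬↷′ : ∀ {k l a b} → Inside k l a b → ¬ Sticks k l a b
    ≺⇒¬↷′ (bb p) (bb q) = ≺⇒¬↷ p q
    ≺⇒¬↷′ (kk p) (kk q) = ≺⇒¬↷ p q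
    ≺⇒¬↷′ (sb p) sb = ≺-irrefl p

    ≺⇒¬↶′ : ∀ {k l a b} → Inside k l a b → ¬ Sticks l k b a
    ≺⇒¬↶′ (bb p) (bb q) = ≺⇒¬↶ p q
    ≺⇒¬↶′ (kk p) (kk q) = ≺⇒¬↶ p q

    Comparable : Kind → Kind → Fin n → Fin n → Set
    Comparable k l a b = a ≡ b ⊎ (Inside k l a b ⊎ Inside l k b a)

    bbb : ∀ {a b} → a ≡ b ⊎ (a ≺ b ⊎ b ≺ a) → Comparable base base a b
    bbb = Sum.map₂ (Sum.map bb bb)

    kkk : ∀ {a b} → a ≡ b ⊎ (a ≺ b ⊎ b ≺ a) → Comparable kin kin a b
    kkk = Sum.map₂ (Sum.map kk kk)

    chain′ : ∀ {k l m a b c} → Inside k l a b → Inside k m a c → Comparable l m b c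
    chain′ (bb p) (bb q) = bbb (≺-chain p q)
    chain′ (kk p) (kk q) = kkk (≺-chain p q)
    chain′ (kk p) kb₀ = inj₂ (inj₁ kb₀)
    chain′ (kk p) (kb q) = inj₂ (inj₁ (kb q))
    chain′ kb₀ (kk p) = inj₂ (inj₂ kb₀)
    chain′ kb₀ kb₀ = inj₁ refl
    chain′ kb₀ (kb p) = inj₂ (inj₁ (bb p))
    chain′ (kb p) (kk q) = inj₂ (inj₂ (kb p))
    chain′ (kb p) kb₀ = inj₂ (inj₂ (bb p))
    chain′ (kb p) (kb q) = bbb (≺-chain p q)
    chain′ (sb p) (sb q) = bbb (≺-chain p q)

    enters′ : ∀ {k l m a b c} → κ a ≡ k → κ b ≡ l → κ c ≡ m →
              Sticks k l a b → Sticks k m a c → Comparable l m b c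
    enters′ _ _ _ (bb p) (bb q) = bbb (↷-chain p q)
    enters′ _ _ _ (kk p) (kk q) = kkk (↷-chain p q)
    enters′ _ _ _ sb sb = inj₁ refl
    enters′ _ _ _ sb (sk e) = inj₂ (inj₂ kb₀)
    enters′ _ _ _ (sk e) sb = inj₂ (inj₁ kb₀)
    enters′ p q r (sk e) (sk f) = inj₁ (src-kin p q r e f)

    inside′ : ∀ {k l m a b c} → Sticks k l a b → Inside k m a c →
              Inside l m b c ⊎ Sticks m l c b
    inside′ (bb p) (bb q) = Sum.map bb bb (↷-inside p q)
    inside′ (kk p) (kk q) = Sum.map kk kk (↷-inside p q)
    inside′ (kk p) kb₀ = inj₁ kb₀
    inside′ (kk p) (kb q) = inj₁ (kb q)
    inside′ sb (sb p) = inj₁ (bb p)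
    inside′ (sk e) (sb p) = inj₁ (kb p)

    outward′ : ∀ {k l m a b c} → κ a ≡ k → κ b ≡ l → κ c ≡ m →
               Sticks k l a b → Inside l m b c → Sticks k m a c ⊎ Inside k m a c
    outward′ _ _ _ (bb p) (bb q) = Sum.map bb bb (↷-outward p q)
    outward′ _ _ _ (kk p) (kk q) = Sum.map kk kk (↷-outward p q)
    outward′ _ _ _ (kk p) kb₀ = inj₂ kb₀
    outward′ _ _ _ (kk p) (kb q) = inj₂ (kb q)
    outward′ _ _ _ sb (bb q) = inj₂ (sb q)
    -- A frame `c` around `b` would have to be related to `a` as well, but `b` is outermost within
    -- its kind.
    outward′ p q r (sk e) (kk s) = contradiction s (src-kin-max p q r e)
    outward′ _ _ _ (sk e) kb₀ = inj₁ sb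
    outward′ _ _ _ (sk e) (kb q) = inj₂ (sb q)

    -- If `w` differs in kind from `a` and `b`, then `y` takes its place: `y` is one of `a` and `b`,
    -- or lies inside both, and the old relations exclude each case.
    hollow′ : ∀ {k l m a b w} → Sticks k l a b → Inside m k w a → ¬ Inside m l w b
    hollow′ (bb p) (bb q) (bb r) = ↷-hollow p q r
    hollow′ (bb p) kb₀ kb₀ = ↷-asym p p
    hollow′ (bb p) kb₀ (kb r) = ≺⇒¬↷ r p
    hollow′ (bb p) (kb q) kb₀ = ≺⇒¬↶ q p
    hollow′ (bb p) (kb q) (kb r) = ↷-hollow p q r
    hollow′ (bb p) (sb q) (sb r) = ↷-hollow p q r
    hollow′ (kk p) (kk q) (kk r) = ↷-hollow p q r

    edge′ : ∀ k l {a b} → κ a ≡ k → κ b ≡ l → E a b → Sticks k l a b ⊎ Sticks l k b a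
    edge′ base base p q e = Sum.map bb bb (edge⇒↷ e)
    edge′ base kin p q e = contradiction (E-sym e) (kin-base q p)
    edge′ base src p q e with refl ← src-base q p (E-sym e) = inj₂ sb
    edge′ kin base p q e = contradiction e (kin-base p q)
    edge′ kin kin p q e = Sum.map kk kk (edge⇒↷ e)
    edge′ kin src p q e = inj₂ (sk (E-sym e))
    edge′ src base p q e with refl ← src-base p q e = inj₁ sb
    edge′ src kin p q e = inj₁ (sk e)
    edge′ src src p q e = contradiction e (src-src p q)

    edge⁻′ : ∀ {k l a b} → κ a ≡ k → Sticks k l a b → E a b
    edge⁻′ _ (bb p) = ↷⇒edge p
    edge⁻′ _ (kk p) = ↷⇒edge p
    edge⁻′ p sb = src-y p
    edge⁻′ _ (sk e) = e

    -- Every new pair starts at a source, and nothing sticks out of a source, so a descending chain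
    -- stops there.
    wf′ : WellFounded (λ a b → Sticks (κ a) (κ b) a b)
    wf′ v = go (↷-wf v)
      where
      target : ∀ {k l a b} → Sticks k l a b → l ≢ src
      target (bb _) ()
      target (kk _) ()
      target sb ()
      target (sk _) ()
      source : ∀ {k l a b} → Sticks k l a b → k ≡ src ⊎ a ↷ b
      source (bb q) = inj₂ q
      source (kk q) = inj₂ q
      source sb = inj₁ refl
      source (sk _) = inj₁ refl
      go : ∀ {v} → Acc _↷_ v → Acc (λ a b → Sticks (κ a) (κ b) a b) v
      go (acc rs) = acc λ s →
        [ (λ p → acc λ s′ → contradiction p (target s′)) , (λ p → go (rs p)) ]′ (source s)

  nesting : Nesting E
  nesting = record
    { _≺_ = λ a b → Inside (κ a) (κ b) a b ; _↷_ = λ a b → Sticks (κ a) (κ b) a b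
    ; _≺?_ = λ a b → inside? (κ a) (κ b) a b
    ; _↷?_ = λ a b → sticks? (κ a) (κ b) a b
    ; ≺-trans = trans′ ; ≺-irrefl = irrefl′ ; ↷-wf = wf′
    ; ≺⇒¬↷ = ≺⇒¬↷′ ; ≺⇒¬↶ = ≺⇒¬↶′
    ; ≺-chain = chain′ ; ↷-chain = enters′ refl refl refl
    ; ↷-inside = inside′ ; ↷-outward = outward′ refl refl refl ; ↷-hollow = hollow′
    ; edge⇒↷ = edge′ _ _ refl refl ; ↷⇒edge = edge⁻′ refl }

  private
    -- A triple of a single kind was bad before. Nothing of kind `base` sticks out of kind `kin`, so
    -- in a mixed triple `a` is a source and `c` is `y`; then `b` contains `y` and cannot stick out
    -- of it.
    bad′ : ∀ {k l m a b c} → Inside k l a b → Sticks k m a c → Sticks l m b c → Bad (a , b , c)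
    bad′ (bb p) (bb q) (bb r) = p , q , r
    bad′ (kk p) (kk q) (kk r) = p , q , r
    bad′ (sb p) sb (bb r) = contradiction r (≺⇒¬↶ p)

  bad-preserved : ∀ τ → Nesting.Bad nesting τ → Bad τ
  bad-preserved _ (p , q , r) = bad′ p q r

  removed : ∀ {x z} → κ x ≡ src → ¬ y ≺ z → ¬ Nesting.Bad nesting (x , z , y)
  removed p ¬y≺z (q , _) = ¬y≺z (anchored q p)
    where
    anchored : ∀ {k l a b} → Inside k l a b → k ≡ src → y ≺ b
    anchored (sb r) _ = r

-- Eliminating all bad triples.

module Repair {n : ℕ} {E : Fin n → Fin n → Set} (G : SubdivisionLike E) where
  open SubdivisionLike G

  record Repaired (S : Nesting E) : Set₁ where
    field
      result        : Nesting E
      bad-preserved : ∀ τ → Nesting.Bad result τ → Nesting.Bad S τ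
      τ             : Fin n × Fin n × Fin n
      was-bad       : Nesting.Bad S τ
      removed       : ¬ Nesting.Bad result τ

  module _ (S : Nesting E) where
    open Nesting S

    -- An internal vertex has degree at most two, so `x` and `z` are all the neighbours of `y`.
    repair-internal : ∀ {x z y} → Bad (x , z , y) → ¬ Branch y → Repaired S
    repair-internal {x} {z} {y} bad@(x≺z , x↷y , z↷y) ¬b = record
      { result = F.nesting ; bad-preserved = F.bad-preserved
      ; was-bad = bad ; removed = F.removed }
      where
      only : ∀ {b} → E y b → b ≡ x ⊎ b ≡ z
      only e with internal-degree ¬b e (E-sym (↷⇒edge x↷y)) (E-sym (↷⇒edge z↷y))
      ... | inj₁ p = inj₁ p
      ... | inj₂ (inj₁ p) = inj₂ p
      ... | inj₂ (inj₂ refl) = contradiction x≺z ≺-irrefl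
      module F = Flip G S bad only

    module AtBranch {x z y : Fin n} (bad : Bad (x , z , y)) (by : Branch y)
                    (all-branch : ∀ {x z y} → Bad (x , z , y) → Branch y) where
      x≺z = proj₁ bad
      x↷y = proj₁ (proj₂ bad)
      z↷y = proj₂ (proj₂ bad)

      ¬bz : ¬ Branch z
      ¬bz = branch-isolated by (E-sym (↷⇒edge z↷y))

      other-end : ∀ {a b c} → ¬ Branch a → E a y → E a b → E a c → b ≢ y → c ≢ y → b ≡ c
      other-end ¬ba ey eb ec b≢y c≢y with internal-degree ¬ba ey eb ec
      ... | inj₁ p = contradiction (sym p) b≢y
      ... | inj₂ (inj₁ p) = contradiction (sym p) c≢y
      ... | inj₂ (inj₂ p) = p

      -- If `b` is not inside `z`, then `z` sticks out of `b` and `(a , z , b)` is bad. So `b` is a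
      -- branch vertex, and `z` has only one branch neighbour.
      exit : ∀ {a b} → a ≺ z → a ↷ b → b ≺ z ⊎ b ≡ y
      exit {a} {b} a≺z a↷b with ↷-inside a↷b a≺z
      ... | inj₁ p = inj₁ p
      ... | inj₂ z↷b = inj₂ (branch-unique (all-branch (a≺z , a↷b , z↷b)) by
                               (E-sym (↷⇒edge z↷b)) (↷⇒edge z↷y))

      -- The vertex that links `z` to its own inside. There is at most one, since `z` is internal
      -- and `y` is one of its neighbours.
      T : Fin n → Set
      T t = t ↷ z × ∃[ w ] (w ≺ z × t ↷ w)

      T? : ∀ t → Dec (T t)
      T? t = (t ↷? z) ×-dec any? (λ w → (w ≺? z) ×-dec (t ↷? w))

      -- Z becomes the sources and K the part moved into y: together they are the inside
      -- of z, completed by z and its other neighbour when the latter links z to its inside.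
      Z K : Fin n → Set
      Z a = (a ≺ z × a ↷ y) ⊎ (a ≡ z × ∃ T)
      K a = (a ≺ z × ¬ a ↷ y) ⊎ T a

      Z? : ∀ a → Dec (Z a)
      Z? a = ((a ≺? z) ×-dec (a ↷? y)) ⊎-dec ((a ≟ z) ×-dec any? T?)

      K? : ∀ a → Dec (K a)
      K? a = ((a ≺? z) ×-dec ¬? (a ↷? y)) ⊎-dec T? a

      κ : Fin n → Kind
      κ a with Z? a | K? a
      ... | yes _ | _ = src
      ... | no _ | yes _ = kin
      ... | no _ | no _ = base

      κ-src : ∀ {a} → κ a ≡ src → Z a
      κ-src {a} p with Z? a | K? a
      ... | yes q | _ = q
      κ-src () | no _ | yes _
      κ-src () | no _ | no _

      κ-kin : ∀ {a} → κ a ≡ kin → K a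
      κ-kin {a} p with Z? a | K? a
      κ-kin () | yes _ | _
      κ-kin p | no _ | yes q = q
      κ-kin () | no _ | no _

      κ-base : ∀ {a} → κ a ≡ base → ¬ Z a × ¬ K a
      κ-base {a} p with Z? a | K? a
      κ-base () | yes _ | _
      κ-base () | no _ | yes _
      κ-base p | no q | no r = q , r

      base-outside : ∀ {a} → κ a ≡ base → ¬ a ≺ z
      base-outside {a} p a≺z with κ-base p | a ↷? y
      ... | ¬Z , _ | yes q = ¬Z (inj₁ (a≺z , q))
      ... | _ , ¬K | no q = ¬K (inj₁ (a≺z , q))

      T-internal : ∀ {t} → T t → ¬ Branch t
      T-internal (t↷z , _) bt
        with refl ← branch-unique bt by (↷⇒edge t↷z) (↷⇒edge z↷y) = ↷-asym t↷z z↷y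

      T≢y : ∀ {t} → T t → t ≢ y
      T≢y (t↷z , _) refl = ↷-asym t↷z z↷y

      T-nbr : ∀ {t b} → T t → E t b → b ≡ z ⊎ b ≺ z
      T-nbr h@(t↷z , w , w≺z , t↷w) e
        with internal-degree (T-internal h) e (↷⇒edge t↷z) (↷⇒edge t↷w)
      ... | inj₁ p = inj₁ p
      ... | inj₂ (inj₁ refl) = inj₂ w≺z
      ... | inj₂ (inj₂ refl) = contradiction w≺z ≺-irrefl

      y⊀z : ¬ y ≺ z
      y⊀z p = ≺⇒¬↶ p z↷y

      kin≢y : ∀ {b} → κ b ≡ kin → b ≢ y
      kin≢y p refl with κ-kin p
      ... | inj₁ (q , _) = y⊀z q
      ... | inj₂ q = T≢y q refl

      src-y : ∀ {a} → κ a ≡ src → E a y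
      src-y p with κ-src p
      ... | inj₁ (_ , a↷y) = ↷⇒edge a↷y
      ... | inj₂ (refl , _) = ↷⇒edge z↷y

      src-internal : ∀ {a} → κ a ≡ src → ¬ Branch a
      src-internal p = branch-isolated by (E-sym (src-y p))

      κy : κ y ≡ base
      κy with Z? y | K? y
      ... | yes (inj₁ (p , _)) | _ = contradiction p y⊀z
      ... | yes (inj₂ (refl , _)) | _ = ⊥-elim (E-irrefl (↷⇒edge z↷y))
      ... | no _ | yes (inj₁ (p , _)) = contradiction p y⊀z
      ... | no _ | yes (inj₂ p) = contradiction refl (T≢y p)
      ... | no _ | no _ = refl

      -- An edge leaving the inside of `z` goes to `y`, or comes from a frame that also sticks out
      -- of `z` and hence satisfies `T`. The neighbours of a vertex in `T` are inside `z` or equal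
      -- to `z`, which is then a source.
      kin-base : ∀ {a b} → κ a ≡ kin → κ b ≡ base → ¬ E a b
      kin-base {a} {b} p q e with κ-kin p
      ... | inj₂ h with T-nbr h e
      ...   | inj₁ refl = proj₁ (κ-base q) (inj₂ (refl , a , h))
      ...   | inj₂ b≺z = base-outside q b≺z
      kin-base p q e | inj₁ (a≺z , ¬a↷y) with edge⇒↷ e
      ... | inj₁ a↷b with exit a≺z a↷b
      ...   | inj₁ b≺z = base-outside q b≺z
      ...   | inj₂ refl = ¬a↷y a↷b
      kin-base {a} p q e | inj₁ (a≺z , ¬a↷y) | inj₂ b↷a with ↷-outward b↷a a≺z
      ... | inj₁ b↷z = proj₂ (κ-base q) (inj₂ (b↷z , a , a≺z , b↷a))
      ... | inj₂ b≺z = base-outside q b≺z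

      src-src : ∀ {a b} → κ a ≡ src → κ b ≡ src → ¬ E a b
      src-src p q e = triangle-free e (src-y q) (E-sym (src-y p))

      -- A target `b` inside `z` would be comparable with `y`. It cannot lie inside `y`, because `z`
      -- sticks out of `y`; nor can it contain `y`, because `z` does not.
      sole : ∀ {a b} → a ≺ z → a ↷ y → a ↷ b → b ≡ y
      sole {a} {b} a≺z a↷y a↷b with exit a≺z a↷b
      ... | inj₂ p = p
      ... | inj₁ b≺z with ↷-chain a↷b a↷y
      ...   | inj₁ p = p
      ...   | inj₂ (inj₁ b≺y) = contradiction b≺y (↷-hollow z↷y b≺z)
      ...   | inj₂ (inj₂ y≺b) = contradiction (≺-trans y≺b b≺z) y⊀z

      src-base : ∀ {a b} → κ a ≡ src → κ b ≡ base → E a b → b ≡ y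
      src-base {a} {b} p q e with κ-src p
      ... | inj₂ (refl , t , h) with b ≟ y
      ...   | yes r = r
      ...   | no r with refl ← other-end ¬bz (↷⇒edge z↷y) e (E-sym (↷⇒edge (proj₁ h))) r (T≢y h)
                   = contradiction (inj₂ h) (proj₂ (κ-base q))
      src-base {a} p q e | inj₁ (a≺z , a↷y) with edge⇒↷ e
      ... | inj₁ a↷b = sole a≺z a↷y a↷b
      ... | inj₂ b↷a with ↷-outward b↷a a≺z
      ...   | inj₁ b↷z = contradiction (inj₂ (b↷z , a , a≺z , b↷a)) (proj₂ (κ-base q))
      ...   | inj₂ b≺z = contradiction b≺z (base-outside q)

      src-kin : ∀ {a b c} → κ a ≡ src → κ b ≡ kin → κ c ≡ kin → E a b → E a c → b ≡ c
      src-kin p q r e f = other-end (src-internal p) (src-y p) e f (kin≢y q) (kin≢y r)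

      -- If `a` is `z`, then `c` would be a second such neighbour of `z` or put `b` inside `z`. If
      -- `a` is inside `z`, then `c` would be a second such neighbour of `a` or contain `a`; in the
      -- latter case `c` contains `y` or sticks out of it, and neither is compatible with `K c`.
      src-kin-max : ∀ {a b c} → κ a ≡ src → κ b ≡ kin → κ c ≡ kin → E a b → ¬ b ≺ c
      src-kin-max {a} {b} {c} p q r e b≺c with κ-src p
      ... | inj₂ (refl , t , t↷z , _) with edge⇒↷ e | κ-kin q | κ-kin r
      ...   | _ | inj₁ (b≺z , _) | _ = [ ≺⇒¬↶ b≺z , ≺⇒¬↷ b≺z ]′ (edge⇒↷ e)
      ...   | _ | inj₂ (b↷z , _) | inj₁ (c≺z , _) = ≺⇒¬↷ (≺-trans b≺c c≺z) b↷z
      ...   | _ | inj₂ _ | inj₂ (c↷z , _)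
              with refl ← src-kin p q r e (E-sym (↷⇒edge c↷z)) = ≺-irrefl b≺c
      src-kin-max {a} {b} {c} p q r e b≺c | inj₁ (a≺z , a↷y) with edge⇒↷ e
      ... | inj₁ a↷b = kin≢y q (sole a≺z a↷y a↷b)
      ... | inj₂ b↷a with ↷-inside b↷a b≺c
      ...   | inj₂ c↷a with refl ← src-kin p q r e (E-sym (↷⇒edge c↷a)) = ≺-irrefl b≺c
      ...   | inj₁ a≺c with κ-kin r | ↷-inside a↷y a≺c
      ...     | inj₁ (c≺z , _) | inj₁ y≺c = y⊀z (≺-trans y≺c c≺z)
      ...     | inj₁ (_ , ¬c↷y) | inj₂ c↷y = ¬c↷y c↷y
      ...     | inj₂ (c↷z , _) | inj₂ c↷y =
                  triangle-free (↷⇒edge c↷z) (↷⇒edge z↷y) (E-sym (↷⇒edge c↷y))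
      ...     | inj₂ (c↷z , _) | inj₁ y≺c with ↷-outward z↷y y≺c
      ...       | inj₁ z↷c = ↷-asym z↷c c↷z
      ...       | inj₂ z≺c = ≺⇒¬↶ z≺c c↷z

      E? : Decidable E
      E? a b with (a ↷? b) ⊎-dec (b ↷? a)
      ... | yes p = yes ([ ↷⇒edge , E-sym ∘ ↷⇒edge ]′ p)
      ... | no ¬p = no (¬p ∘ edge⇒↷)

      module M = Move G S E? y κ κy kin-base src-src src-base src-y src-kin src-kin-max

      κx : κ x ≡ src
      κx with Z? x
      ... | yes _ = refl
      ... | no q = contradiction (inj₁ (x≺z , x↷y)) q

      repaired : Repaired S
      repaired = record
        { result = M.nesting ; bad-preserved = M.bad-preserved
        ; was-bad = bad ; removed = M.removed κx y⊀z }

    anyTriple? : {P : Fin n × Fin n × Fin n → Set} → (∀ τ → Dec (P τ)) → Dec (∃ P)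
    anyTriple? P? with any? (λ x → any? (λ z → any? (λ y → P? (x , z , y))))
    ... | yes (x , z , y , p) = yes ((x , z , y) , p)
    ... | no ¬p = no λ { ((x , z , y) , p) → ¬p (x , z , y , p) }

    repair : ∃ Bad → Repaired S
    repair ((x , z , y) , bad)
      with anyTriple? (λ τ → bad? τ ×-dec ¬? (branch? (proj₂ (proj₂ τ))))
    ... | yes (_ , bad′ , ¬b) = repair-internal bad′ ¬b
    ... | no none = AtBranch.repaired bad (all-branch bad) all-branch
      where
      all-branch : ∀ {x z y} → Bad (x , z , y) → Branch y
      all-branch {x} {z} {y} h with branch? y
      ... | yes b = b
      ... | no ¬b = contradiction (_ , h , ¬b) none

  Strict : Nesting E → Set
  Strict S = ∀ τ → ¬ Nesting.Bad S τ

  _≟³_ : (σ τ : Fin n × Fin n × Fin n) → Dec (σ ≡ τ)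
  _≟³_ = ≡-dec _≟_ (≡-dec _≟_ _≟_)

  -- A repair creates no bad triple and removes at least one. The list `L` covers all triples that
  -- can still be bad and loses an entry each time; `m` bounds its length.
  strictify : Nesting E → Σ (Nesting E) Strict
  strictify S = go _ ℕ.≤-refl S λ { (x , z , y) _ → ∈-cartesianProduct⁺ (∈-allFin x)
                                       (∈-cartesianProduct⁺ (∈-allFin z) (∈-allFin y)) }
    where
    go : ∀ m {L} → length L ≤ m → (S : Nesting E) → (∀ τ → Nesting.Bad S τ → τ ∈ L) →
         Σ (Nesting E) Strict
    go m {L} ℓ S listed with anyTriple? S (Nesting.bad? S)
    ... | no none = S , λ τ b → none (τ , b)
    go zero {[]} _ S listed | yes (τ , b) with () ← listed τ b
    go (suc m) {L} ℓ S listed | yes w =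
      go m (ℕ.≤-pred (ℕ.<-≤-trans (filter-notAll P? L (lose (listed R.τ R.was-bad) λ q → q refl)) ℓ))
         R.result
         λ τ b → ∈-filter⁺ P? (listed τ (R.bad-preserved τ b)) λ { refl → R.removed b }
      where
      module R = Repaired (repair S w)
      P? = λ σ → ¬? (σ ≟³ R.τ)

-- Embedding a graph without bad triples into an iterate of `NEXT`.

module Embedding {n : ℕ} {E : Fin n → Fin n → Set} (G : SubdivisionLike E) (S : Nesting E)
                 (strict : Repair.Strict G S) where
  open SubdivisionLike G
  open Nesting S

  -- Otherwise `(x , z , y)` would be bad; this is how strictness is used.
  ↷-stays-inside : ∀ {x y z} → x ↷ y → x ≺ z → y ≺ z
  ↷-stays-inside p q with ↷-inside p q
  ... | inj₁ r = r
  ... | inj₂ r = contradiction (q , p , r) (strict _)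

  -- The subsets of `L` that stable sets have to cut out: nested frames are pairwise non-adjacent,
  -- and upward closure lets membership of an outermost frame govern everything inside it.
  record UpChain (L : List (Fin n)) (U : Fin n → Set) : Set where
    field
      chain : ∀ {x y} → x ∈ L → y ∈ L → U x → U y → x ≡ y ⊎ (x ≺ y ⊎ y ≺ x)
      up    : ∀ {x y} → x ∈ L → y ∈ L → U x → x ≺ y → U y

  -- An embedding of the members of `L` only; the values of `place` elsewhere carry no meaning. The
  -- field `trace` strengthens the induction so that a further root can be attached.
  record Realised (L : List (Fin n)) (Q : GSP) : Set₁ where
    field
      place     : Fin n → GSP.V Q
      injective : ∀ {x y} → x ∈ L → y ∈ L → place x ≡ place y → x ≡ y
      edge⁺     : ∀ {x y} → x ∈ L → y ∈ L → E x y → GSP.E Q (place x) (place y)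
      edge⁻     : ∀ {x y} → x ∈ L → y ∈ L → GSP.E Q (place x) (place y) → E x y
      trace     : {U : Fin n → Set} → (∀ x → Dec (U x)) → UpChain L U →
                  ∃[ j ] (∀ {x} → x ∈ L → U x ⇔ GSP.S Q j (place x))

  restrict : ∀ {L L′ U} → (∀ {x} → x ∈ L′ → x ∈ L) → UpChain L U → UpChain L′ U
  restrict s c = record { chain = λ p q → chain (s p) (s q) ; up = λ p q → up (s p) (s q) }
    where open UpChain c

  realise-[] : ∀ {Q} → GSP.V Q → GSP.I Q → Realised [] Q
  realise-[] v i = record
    { place = λ _ → v ; injective = λ () ; edge⁺ = λ () ; edge⁻ = λ () ; trace = λ _ _ → i , λ () }

  module Step (L : List (Fin n)) {s : Fin n} (s∈ : s ∈ L) (root : ∀ {x} → x ∈ L → ¬ s ≺ x)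
              (unentered : ∀ {x} → x ∈ L → ¬ x ↷ s) where

    below? = λ x → x ≺? s
    rest? = λ x → ¬? (x ≟ s) ×-dec ¬? (x ≺? s)

    below rest : List (Fin n)
    below = filter below? L
    rest = filter rest? L

    below⊆ : ∀ {x} → x ∈ below → x ∈ L
    below⊆ = proj₁ ∘ ∈-filter⁻ below?

    rest⊆ : ∀ {x} → x ∈ rest → x ∈ L
    rest⊆ = proj₁ ∘ ∈-filter⁻ rest?

    data Part (x : Fin n) : Set where
      isRoot  : x ≡ s → Part x
      isBelow : x ≺ s → Part x
      isRest  : x ≢ s → ¬ x ≺ s → Part x

    part : ∀ x → Part x
    part x with x ≟ s | x ≺? s
    ... | yes p | _ = isRoot p
    ... | no _ | yes p = isBelow p
    ... | no p | no q = isRest p q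

    -- A frame around an out-neighbour of `s` is an out-neighbour too, since no frame in the list
    -- contains `s`.
    entered : UpChain rest (s ↷_)
    entered = record { chain = λ _ _ → ↷-chain ; up = λ _ y∈ p q → up y∈ (↷-outward p q) }
      where
      up : ∀ {y} → y ∈ rest → s ↷ y ⊎ s ≺ y → s ↷ y
      up _ (inj₁ p) = p
      up y∈ (inj₂ p) = contradiction p (root (rest⊆ y∈))

    module _ (Q : GSP) (r : Realised rest Q) (b : Realised below Q) (τ : GSP.I Q)
             (τ-trace : ∀ {x} → x ∈ rest → s ↷ x ⇔ GSP.S Q τ (Realised.place r x)) where
      private
        module r = Realised r
        module b = Realised b

        -- s is the new vertex attached to the stable set τ of the copy of Q containing the
        -- rest; what lies below s goes into the copy indexed by τ ∪ {s}.
        locate : ∀ {x} → Part x → NV (NEXT Q)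
        locate (isRoot _) = old (new τ τ)
        locate {x} (isBelow _) = copy (τ , τ , true) (old (b.place x))
        locate {x} (isRest _ _) = old (copy τ (r.place x))

        below⁺ : ∀ {x} → x ∈ L → x ≺ s → x ∈ below
        below⁺ = ∈-filter⁺ below?

        rest⁺ : ∀ {x} → x ∈ L → x ≢ s → ¬ x ≺ s → x ∈ rest
        rest⁺ x∈ p q = ∈-filter⁺ rest? x∈ (p , q)

        old-injective : ∀ {P u v} → old {P} u ≡ old v → u ≡ v
        old-injective refl = refl

        copy-injective : ∀ {P i u v} → copy {P} i u ≡ copy i v → u ≡ v
        copy-injective refl = refl

        injective : ∀ {x y} (p : Part x) (q : Part y) → x ∈ L → y ∈ L →
                    locate p ≡ locate q → x ≡ y
        injective (isRoot refl) (isRoot refl) _ _ _ = refl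
        injective (isRoot _) (isBelow _) _ _ ()
        injective (isRoot _) (isRest _ _) _ _ ()
        injective (isBelow _) (isRoot _) _ _ ()
        injective (isBelow p) (isBelow q) x∈ y∈ e =
          b.injective (below⁺ x∈ p) (below⁺ y∈ q) (old-injective (copy-injective e))
        injective (isBelow _) (isRest _ _) _ _ ()
        injective (isRest _ _) (isRoot _) _ _ ()
        injective (isRest _ _) (isBelow _) _ _ ()
        injective (isRest p p′) (isRest q q′) x∈ y∈ e =
          r.injective (rest⁺ x∈ p p′) (rest⁺ y∈ q q′) (copy-injective (old-injective e))

        ¬root-below : ∀ {x} → x ≺ s → ¬ E s x
        ¬root-below p e = [ ≺⇒¬↶ p , ≺⇒¬↷ p ]′ (edge⇒↷ e)

        -- Strictness keeps the targets of frames inside `s` inside `s`. A frame from outside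
        -- sticking out of one of them would stick out of `s`, which is unentered.
        ¬below-rest : ∀ {x y} → x ≺ s → y ∈ L → ¬ y ≺ s → ¬ E x y
        ¬below-rest p y∈ q e with edge⇒↷ e
        ... | inj₁ x↷y = q (↷-stays-inside x↷y p)
        ... | inj₂ y↷x = [ unentered y∈ , q ]′ (↷-outward y↷x p)

        root-rest : ∀ {x} → x ∈ rest → E s x → GSP.S Q τ (r.place x)
        root-rest x∈ e with edge⇒↷ e
        ... | inj₁ p = Equivalence.to (τ-trace x∈) p
        ... | inj₂ p = contradiction p (unentered (rest⊆ x∈))

        edge⁺ : ∀ {x y} (p : Part x) (q : Part y) → x ∈ L → y ∈ L →
                E x y → NE (NEXT Q) (locate p) (locate q)
        edge⁺ (isRoot refl) (isRoot refl) _ _ e = contradiction e E-irrefl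
        edge⁺ (isRoot refl) (isBelow q) _ _ e = contradiction e (¬root-below q)
        edge⁺ (isRoot refl) (isRest q q′) _ y∈ e = oldE (newE₁ τ τ _ (root-rest (rest⁺ y∈ q q′) e))
        edge⁺ (isBelow p) (isRoot refl) _ _ e = contradiction (E-sym e) (¬root-below p)
        edge⁺ (isBelow p) (isBelow q) x∈ y∈ e =
          copyE _ (oldE (b.edge⁺ (below⁺ x∈ p) (below⁺ y∈ q) e))
        edge⁺ (isBelow p) (isRest _ q′) _ y∈ e = contradiction e (¬below-rest p y∈ q′)
        edge⁺ (isRest p p′) (isRoot refl) x∈ _ e =
          oldE (newE₂ τ τ _ (root-rest (rest⁺ x∈ p p′) (E-sym e)))
        edge⁺ (isRest _ p′) (isBelow q) x∈ _ e = contradiction (E-sym e) (¬below-rest q x∈ p′)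
        edge⁺ (isRest p p′) (isRest q q′) x∈ y∈ e =
          oldE (copyE τ (r.edge⁺ (rest⁺ x∈ p p′) (rest⁺ y∈ q q′) e))

        edge⁻ : ∀ {x y} (p : Part x) (q : Part y) → x ∈ L → y ∈ L →
                NE (NEXT Q) (locate p) (locate q) → E x y
        edge⁻ (isRoot _) (isRoot _) _ _ (oldE ())
        edge⁻ (isRoot refl) (isRest q q′) _ y∈ (oldE (newE₁ _ _ _ h)) =
          ↷⇒edge (Equivalence.from (τ-trace (rest⁺ y∈ q q′)) h)
        edge⁻ (isBelow p) (isBelow q) x∈ y∈ (copyE _ (oldE e)) =
          b.edge⁻ (below⁺ x∈ p) (below⁺ y∈ q) e
        edge⁻ (isRest p p′) (isRoot refl) x∈ _ (oldE (newE₂ _ _ _ h)) =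
          E-sym (↷⇒edge (Equivalence.from (τ-trace (rest⁺ x∈ p p′)) h))
        edge⁻ (isRest p p′) (isRest q q′) x∈ y∈ (oldE (copyE _ e)) =
          r.edge⁻ (rest⁺ x∈ p p′) (rest⁺ y∈ q q′) e

        trace : {U : Fin n → Set} → (∀ x → Dec (U x)) → UpChain L U →
                ∃[ j ] (∀ {x} (p : Part x) → x ∈ L → U x ⇔ NS (NEXT Q) j (locate p))
        trace {U} U? c with U? s
        -- A chain through `s` contains nothing of the rest. The index `(τ , τ , true)` contributes
        -- `s`, and its `τ` sits on old vertices where nothing is placed; `j` cuts out the part
        -- below `s` in the copy with that index.
        ... | yes us = ((τ , τ , true) , (j , j , false) , false) , λ p x∈ → mk⇔ (to p x∈) (from p x∈)
          where
          open UpChain c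
          jt = b.trace U? (restrict below⊆ c)
          j = proj₁ jt
          to : ∀ {x} (p : Part x) → x ∈ L → U x →
               NS (NEXT Q) ((τ , τ , true) , (j , j , false) , false) (locate p)
          to (isRoot _) _ _ = inS₀ _ _ _ (inNew τ τ)
          to (isBelow p) x∈ u = inT _ _ _ (inS₀ j j _ (Equivalence.to (proj₂ jt (below⁺ x∈ p)) u))
          to (isRest p q) x∈ u with chain x∈ s∈ u us
          ... | inj₁ r = contradiction r p
          ... | inj₂ (inj₁ r) = contradiction r q
          ... | inj₂ (inj₂ r) = contradiction r (root x∈)
          from : ∀ {x} (p : Part x) → x ∈ L →
                 NS (NEXT Q) ((τ , τ , true) , (j , j , false) , false) (locate p) → U x
          from (isRoot refl) _ _ = us
          from (isBelow p) x∈ (inT _ _ _ (inS₀ _ _ _ h)) = Equivalence.from (proj₂ jt (below⁺ x∈ p)) h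
          from (isRest _ _) _ (inS₀ _ _ _ ())
        -- By upward closure nothing below `s` belongs to `U`. The first `(τ , j , false)` cuts out
        -- the rest; the second lives in a copy that differs, by its `false`, from the copy holding
        -- the frames below `s`.
        ... | no ¬us = ((τ , j , false) , (τ , j , false) , false) , λ p x∈ → mk⇔ (to p x∈) (from p x∈)
          where
          open UpChain c
          jt = r.trace U? (restrict rest⊆ c)
          j = proj₁ jt
          to : ∀ {x} (p : Part x) → x ∈ L → U x →
               NS (NEXT Q) ((τ , j , false) , (τ , j , false) , false) (locate p)
          to (isRoot refl) _ u = contradiction u ¬us
          to (isBelow p) x∈ u = contradiction (up x∈ s∈ u p) ¬us
          to (isRest p q) x∈ u = inS₀ _ _ _ (inT τ j _ (Equivalence.to (proj₂ jt (rest⁺ x∈ p q)) u))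
          from : ∀ {x} (p : Part x) → x ∈ L →
                 NS (NEXT Q) ((τ , j , false) , (τ , j , false) , false) (locate p) → U x
          from (isRoot _) _ (inS₀ _ _ _ ())
          from (isRest p q) x∈ (inS₀ _ _ _ (inT _ _ _ h)) =
            Equivalence.from (proj₂ jt (rest⁺ x∈ p q)) h

      realise-step : Realised L (NEXT (NEXT Q))
      realise-step = record
        { place = λ x → locate (part x)
        ; injective = injective (part _) (part _)
        ; edge⁺ = edge⁺ (part _) (part _)
        ; edge⁻ = edge⁻ (part _) (part _)
        ; trace = λ U? c → let (j , h) = trace U? c in j , h (part _) }

  ≻-wf : WellFounded (flip _≺_)
  ≻-wf = spo-noetherian record
    { isEquivalence = isEquivalence
    ; irrefl = λ { refl → ≺-irrefl } ; trans = ≺-trans ; <-resp-≈ = resp₂ _≺_ }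

  Root : List (Fin n) → Fin n → Set
  Root L r = r ∈ L × (∀ {x} → x ∈ L → ¬ r ≺ x)

  root-above : ∀ {L x} → x ∈ L → Acc (flip _≺_) x → ∃ (Root L)
  root-above {L} {x} x∈ (acc rs) with Any.any? (x ≺?_) L
  ... | yes w = let (_ , y∈ , p) = find w in root-above y∈ (rs p)
  ... | no none = x , x∈ , λ y∈ p → none (lose y∈ p)

  -- If `x` sticks out of the root `r`, then `x` is a root as well, since a frame around `x` would
  -- contain `r`. Well-foundedness ends the search.
  unentered-root : ∀ {L r} → Root L r → Acc _↷_ r →
                   ∃[ s ] (Root L s × (∀ {x} → x ∈ L → ¬ x ↷ s))
  unentered-root {L} {r} (r∈ , top) (acc rs) with Any.any? (_↷? r) L
  ... | no none = r , (r∈ , top) , λ x∈ p → none (lose x∈ p)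
  ... | yes w = let (_ , x∈ , p) = find w in
    unentered-root (x∈ , λ y∈ q → top y∈ (↷-stays-inside p q)) (rs p)

  -- Peeling off one root costs two applications of `NEXT`.
  level : ℕ → ℕ
  level zero = zero
  level (suc m) = suc (suc (level m))

  some-vertex : ∀ k → GSP.V (NEXT^ k)
  some-vertex zero = tt
  some-vertex (suc k) = old (some-vertex k)

  some-index : ∀ k → GSP.I (NEXT^ k)
  some-index zero = tt
  some-index (suc k) = some-index k , some-index k , false

  -- The target depends only on the bound `m`, so `rest` and `below` are realised in the same pair
  -- even when their lengths differ.
  realise : ∀ m L → length L ≤ m → Realised L (NEXT^ (level m))
  realise m [] _ = realise-[] (some-vertex (level m)) (some-index (level m))
  realise (suc m) L@(x ∷ _) ℓ
    with unentered-root (proj₂ (root-above (here refl) (≻-wf x))) (↷-wf _)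
  ... | s , (s∈ , root) , unentered = realise-step (NEXT^ (level m)) r b (proj₁ e) (proj₂ e)
    where
    open Step L s∈ root unentered
    r = realise m rest (ℕ.≤-pred (ℕ.<-≤-trans (filter-notAll rest? L (lose s∈ λ p → proj₁ p refl)) ℓ))
    b = realise m below (ℕ.≤-pred (ℕ.<-≤-trans (filter-notAll below? L (lose s∈ ≺-irrefl)) ℓ))
    e = Realised.trace r (s ↷?_) entered

  induced : ∃[ i ] InducedPair (mkGSP (Fin n) E ⊥ (λ ())) (NEXT^ i)
  induced = level (length (allFin n)) , place , (λ x y → injective (∈-allFin x) (∈-allFin y))
          , (λ x y → mk⇔ (edge⁺ (∈-allFin x) (∈-allFin y)) (edge⁻ (∈-allFin x) (∈-allFin y)))
          , λ ()
    where open Realised (realise _ (allFin n) ℕ.≤-refl)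

-- The nesting relations of a restricted frame representation.

module Geometry {n : ℕ} {E : Fin n → Fin n → Set} (G : SubdivisionLike E)
                (F : Fin n → Frame) (rep : IsRestrictedFrameRep n E F) where
  open SubdivisionLike G
  open IsRestrictedFrameRep rep

  private
    a b c d : Fin n → ℚ
    a u = Frame.a (F u)
    b u = Frame.b (F u)
    c u = Frame.c (F u)
    d u = Frame.d (F u)

    a≤b : ∀ u → a u ≤ℚ b u
    a≤b u = ℚ.<⇒≤ (Frame.a<b (F u))

    c≤d : ∀ u → c u ≤ℚ d u
    c≤d u = ℚ.<⇒≤ (Frame.c<d (F u))

    clash : ∀ {p q} {A : Set} → p <ℚ q → q ≤ℚ p → A
    clash h k = contradiction (ℚ.<-≤-trans h k) (ℚ.<-irrefl refl)

    _≺_ _↷_ : Fin n → Fin n → Set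
    x ≺ z = (a z <ℚ a x × b x <ℚ b z) × (c z <ℚ c x × d x <ℚ d z)
    x ↷ y = ((a y <ℚ a x × a x <ℚ b y) × b y <ℚ b x) × (c y <ℚ c x × d x <ℚ d y)

    -- The left side of v meets the region of u but not the frame of u, so it lies in the
    -- interior of u.
    position-by-left-side : ∀ {u v} → u ≢ v → a u ≤ℚ a v → a v ≤ℚ b u →
                            c u ≤ℚ d v → c v ≤ℚ d u → v ≺ u ⊎ v ↷ u
    position-by-left-side {u} {v} u≢v au≤av av≤bu cu≤dv cv≤du = by-right-side (ℚ.<-cmp (b v) (b u))
      where
      left-free = cond2 v u (≢-sym u≢v)
      dv<du : d v <ℚ d u
      dv<du = ℚ.≰⇒> λ h →
        left-free ((a v , d u) , (refl , cv≤du , h) , inj₂ (inj₂ (refl , au≤av , av≤bu)))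
      cu<cv : c u <ℚ c v
      cu<cv = ℚ.≰⇒> λ h →
        left-free ((a v , c u) , (refl , h , cu≤dv) , inj₂ (inj₁ (refl , au≤av , av≤bu)))
      au<av : a u <ℚ a v
      au<av = ℚ.≰⇒> λ h →
        left-free ((a v , c v) , (refl , ℚ.≤-refl , c≤d v)
                  , inj₁ (inj₁ (ℚ.≤-antisym h au≤av , ℚ.<⇒≤ cu<cv , cv≤du)))
      av<bu : a v <ℚ b u
      av<bu = ℚ.≰⇒> λ h →
        left-free ((a v , c v) , (refl , ℚ.≤-refl , c≤d v)
                  , inj₁ (inj₂ (ℚ.≤-antisym av≤bu h , ℚ.<⇒≤ cu<cv , cv≤du)))
      by-right-side : Tri (b v <ℚ b u) (b v ≡ b u) (b u <ℚ b v) → v ≺ u ⊎ v ↷ u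
      by-right-side (tri< h _ _) = inj₁ ((au<av , h) , (cu<cv , dv<du))
      by-right-side (tri≈ _ h _) =
        contradiction (inj₁ (inj₂ (h , ℚ.<⇒≤ cu<cv , cv≤du)))
                      (cond1 v u (≢-sym u≢v) (b v , c v) (inj₂ refl , inj₁ refl))
      by-right-side (tri> _ _ h) = inj₂ (((au<av , av<bu) , h) , (cu<cv , dv<du))

    -- When two regions share a point, the left side lying further right meets the region of the
    -- other frame.
    position : ∀ {u v} → u ≢ v → ∀ {p} → InRegion (F u) p → InRegion (F v) p →
               (u ≺ v ⊎ u ↷ v) ⊎ (v ≺ u ⊎ v ↷ u)
    position {u} {v} u≢v ((au , bu) , (cu , du)) ((av , bv) , (cv , dv)) with ℚ.≤-total (a u) (a v)
    ... | inj₁ h = inj₂ (position-by-left-side u≢v h (ℚ.≤-trans av bu)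
                                               (ℚ.≤-trans cu dv) (ℚ.≤-trans cv du))
    ... | inj₂ h = inj₁ (position-by-left-side (≢-sym u≢v) h (ℚ.≤-trans au bv)
                                               (ℚ.≤-trans cv du) (ℚ.≤-trans cu dv))

    corner : Fin n → Point
    corner x = a x , c x

    corner∈ : ∀ x → InRegion (F x) (corner x)
    corner∈ x = (ℚ.≤-refl , a≤b x) , (ℚ.≤-refl , c≤d x)

    ≺-corner : ∀ {x z} → x ≺ z → InRegion (F z) (corner x)
    ≺-corner {x} ((p , q) , (r , s)) =
      (ℚ.<⇒≤ p , ℚ.≤-trans (a≤b x) (ℚ.<⇒≤ q)) , (ℚ.<⇒≤ r , ℚ.≤-trans (c≤d x) (ℚ.<⇒≤ s))

    ↷-corner : ∀ {x y} → x ↷ y → InRegion (F y) (corner x)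
    ↷-corner {x} (((p , q) , _) , (r , s)) =
      (ℚ.<⇒≤ p , ℚ.<⇒≤ q) , (ℚ.<⇒≤ r , ℚ.≤-trans (c≤d x) (ℚ.<⇒≤ s))

    onFrame⇒inRegion : ∀ {u p} → OnFrame (F u) p → InRegion (F u) p
    onFrame⇒inRegion {u} (inj₁ (inj₁ (refl , p))) = (ℚ.≤-refl , a≤b u) , p
    onFrame⇒inRegion {u} (inj₁ (inj₂ (refl , p))) = (a≤b u , ℚ.≤-refl) , p
    onFrame⇒inRegion {u} (inj₂ (inj₁ (refl , p))) = p , (ℚ.≤-refl , c≤d u)
    onFrame⇒inRegion {u} (inj₂ (inj₂ (refl , p))) = p , (c≤d u , ℚ.≤-refl)

    ≺-inRegion : ∀ {u v p} → u ≺ v → InRegion (F u) p → InRegion (F v) p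
    ≺-inRegion ((p , q) , (r , s)) ((p′ , q′) , (r′ , s′)) =
      (ℚ.≤-trans (ℚ.<⇒≤ p) p′ , ℚ.≤-trans q′ (ℚ.<⇒≤ q)) ,
      (ℚ.≤-trans (ℚ.<⇒≤ r) r′ , ℚ.≤-trans s′ (ℚ.<⇒≤ s))

    ≺-frames-disjoint : ∀ {u v p} → u ≺ v → OnFrame (F u) p → ¬ OnFrame (F v) p
    ≺-frames-disjoint ((p , q) , (r , s)) ou ov with onFrame⇒inRegion ou | ov
    ... | (h , _) , _ | inj₁ (inj₁ (refl , _)) = clash p h
    ... | (_ , h) , _ | inj₁ (inj₂ (refl , _)) = clash q h
    ... | _ , (h , _) | inj₂ (inj₁ (refl , _)) = clash r h
    ... | _ , (_ , h) | inj₂ (inj₂ (refl , _)) = clash s h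

    ↷⇒≢ : ∀ {x y} → x ↷ y → x ≢ y
    ↷⇒≢ (((p , _) , _) , _) refl = ℚ.<-irrefl refl p

    -- The bottom side of `x` crosses the right side of `y` at `(b y , c x)`.
    ↷⇒edge : ∀ {x y} → x ↷ y → E x y
    ↷⇒edge {x} {y} h@(((p , q) , r) , (s , t)) =
      Equivalence.from (represents x y (↷⇒≢ h))
        ((b y , c x) , inj₂ (inj₁ (refl , ℚ.<⇒≤ q , ℚ.<⇒≤ r))
        , inj₁ (inj₂ (refl , ℚ.<⇒≤ s , ℚ.≤-trans (c≤d x) (ℚ.<⇒≤ t))))

    edge⇒↷ : ∀ {x y} → E x y → x ↷ y ⊎ y ↷ x
    edge⇒↷ {x} {y} e with Equivalence.to (represents x y λ { refl → E-irrefl e }) e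
    ... | p , ox , oy with position (λ { refl → E-irrefl e }) (onFrame⇒inRegion ox) (onFrame⇒inRegion oy)
    ...   | inj₁ (inj₁ h) = contradiction oy (≺-frames-disjoint h ox)
    ...   | inj₁ (inj₂ h) = inj₁ h
    ...   | inj₂ (inj₁ h) = contradiction ox (≺-frames-disjoint h oy)
    ...   | inj₂ (inj₂ h) = inj₂ h

    ≺⇒¬↷ : ∀ {x y} → x ≺ y → ¬ x ↷ y
    ≺⇒¬↷ ((_ , p) , _) ((_ , q) , _) = ℚ.<-asym p q

    ≺⇒¬↶ : ∀ {x y} → x ≺ y → ¬ y ↷ x
    ≺⇒¬↶ ((p , _) , _) (((q , _) , _) , _) = ℚ.<-asym p q

    ↷-hollow : ∀ {x y w} → x ↷ y → w ≺ x → ¬ w ≺ y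
    ↷-hollow {x} {y} {w} h p q =
      cond4 x y (↷⇒≢ h) (Equivalence.to (represents x y (↷⇒≢ h)) (↷⇒edge h)) w
        λ _ o → ≺-inRegion p (onFrame⇒inRegion o) , ≺-inRegion q (onFrame⇒inRegion o)

    -- A corner of `x` lies in both regions. If one of `y` and `z` stuck out of the other, `x` would
    -- lie in the intersection, against condition (4).
    ≺-chain : ∀ {x y z} → x ≺ y → x ≺ z → y ≡ z ⊎ (y ≺ z ⊎ z ≺ y)
    ≺-chain {x} {y} {z} p q with y ≟ z
    ... | yes e = inj₁ e
    ... | no y≢z with position y≢z (≺-corner p) (≺-corner q)
    ...   | inj₁ (inj₁ h) = inj₂ (inj₁ h)
    ...   | inj₁ (inj₂ h) = contradiction q (↷-hollow h p)
    ...   | inj₂ (inj₁ h) = inj₂ (inj₂ h)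
    ...   | inj₂ (inj₂ h) = contradiction p (↷-hollow h q)

    -- If one of `y` and `z` stuck out of the other, they would form a triangle with `x`.
    ↷-chain : ∀ {x y z} → x ↷ y → x ↷ z → y ≡ z ⊎ (y ≺ z ⊎ z ≺ y)
    ↷-chain {x} {y} {z} p q with y ≟ z
    ... | yes e = inj₁ e
    ... | no y≢z with position y≢z (↷-corner p) (↷-corner q)
    ...   | inj₁ (inj₁ h) = inj₂ (inj₁ h)
    ...   | inj₁ (inj₂ h) =
              contradiction (E-sym (↷⇒edge q)) (triangle-free (↷⇒edge p) (↷⇒edge h))
    ...   | inj₂ (inj₁ h) = inj₂ (inj₂ h)
    ...   | inj₂ (inj₂ h) =
              contradiction (E-sym (↷⇒edge p)) (triangle-free (↷⇒edge q) (↷⇒edge h))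

    -- A corner of `x` lies in both regions, and the right side of `y` is to the left of that of
    -- `z`, which leaves two positions.
    ↷-inside : ∀ {x y z} → x ↷ y → x ≺ z → y ≺ z ⊎ z ↷ y
    ↷-inside {x} {y} {z} p@((_ , by<bx) , _) q@((_ , bx<bz) , _)
      with position {y} {z} (λ { refl → ≺⇒¬↷ q p }) (↷-corner p) (≺-corner q)
    ... | inj₁ (inj₁ h) = inj₁ h
    ... | inj₁ (inj₂ ((_ , bz<by) , _)) =
            contradiction (ℚ.<-trans by<bx bx<bz) (ℚ.<-asym bz<by)
    ... | inj₂ (inj₁ ((_ , bz<by) , _)) =
            contradiction (ℚ.<-trans by<bx bx<bz) (ℚ.<-asym bz<by)
    ... | inj₂ (inj₂ h) = inj₂ h

    -- The regions of `x` and `z` meet, and the left side of `z` is to the left of that of `x`,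
    -- which leaves two positions.
    ↷-outward : ∀ {x y z} → x ↷ y → y ≺ z → x ↷ z ⊎ x ≺ z
    ↷-outward {x} {y} {z} p@(((ay<ax , _) , _) , _) q@((az<ay , _) , _)
      with position {x} {z} (λ { refl → ≺⇒¬↶ q p }) (corner∈ x) (≺-inRegion q (↷-corner p))
    ... | inj₁ (inj₁ h) = inj₂ h
    ... | inj₁ (inj₂ h) = inj₁ h
    ... | inj₂ (inj₁ ((ax<az , _) , _)) =
            contradiction (ℚ.<-trans az<ay ay<ax) (ℚ.<-asym ax<az)
    ... | inj₂ (inj₂ (((ax<az , _) , _) , _)) =
            contradiction (ℚ.<-trans az<ay ay<ax) (ℚ.<-asym ax<az)

    ↷-wf : WellFounded _↷_
    ↷-wf = WF.Subrelation.wellFounded (λ { (((p , _) , _) , _) → p })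
      (spo-wellFounded {_≈_ = _≡_} {_⊏_ = λ x y → a y <ℚ a x} record
        { isEquivalence = isEquivalence
        ; irrefl = λ { refl → ℚ.<-irrefl refl } ; trans = flip ℚ.<-trans ; <-resp-≈ = resp₂ _ })

  nesting : Nesting E
  nesting = record
    { _≺_ = _≺_ ; _↷_ = _↷_
    ; _≺?_ = λ x z → ((a z ℚ.<? a x) ×-dec (b x ℚ.<? b z)) ×-dec ((c z ℚ.<? c x) ×-dec (d x ℚ.<? d z))
    ; _↷?_ = λ x y → (((a y ℚ.<? a x) ×-dec (a x ℚ.<? b y)) ×-dec (b y ℚ.<? b x))
                     ×-dec ((c y ℚ.<? c x) ×-dec (d x ℚ.<? d y))
    ; ≺-trans = λ { ((p , q) , (r , s)) ((p′ , q′) , (r′ , s′)) →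
                    (ℚ.<-trans p′ p , ℚ.<-trans q q′) , (ℚ.<-trans r′ r , ℚ.<-trans s s′) }
    ; ≺-irrefl = λ { ((p , _) , _) → ℚ.<-irrefl refl p }
    ; ↷-wf = ↷-wf ; ≺⇒¬↷ = ≺⇒¬↷ ; ≺⇒¬↶ = ≺⇒¬↶
    ; ≺-chain = ≺-chain ; ↷-chain = ↷-chain
    ; ↷-inside = ↷-inside ; ↷-outward = ↷-outward ; ↷-hollow = ↷-hollow
    ; edge⇒↷ = edge⇒↷ ; ↷⇒edge = ↷⇒edge }

-- Local structure of subdivisions with paths of at least three edges.

module Subdivision (M : Multigraph) (len : Fin (Multigraph.k M) → ℕ) (3≤len : ∀ e → 3 ≤ len e) where
  open Multigraph M

  private
    Adj : SubV M len → SubV M len → Set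
    Adj = SubAdj M len

    starts : ∀ {p e i} → Adj (inj₁ p) (inj₂ (e , i)) → p ≡ proj₁ (ends e) × toℕ i ≡ 0
    starts (first _ _ h) = refl , h

    stops : ∀ {q e i} → Adj (inj₂ (e , i)) (inj₁ q) → q ≡ proj₂ (ends e) × suc (toℕ i) ≡ len e ∸ 1
    stops (last _ _ h) = refl , h

    steps : ∀ {e e′ i j} → Adj (inj₂ (e , i)) (inj₂ (e′ , j)) → e ≡ e′ × suc (toℕ i) ≡ toℕ j
    steps (step _ _ _ h) = refl , h

    2≤len∸1 : ∀ e → 2 ≤ len e ∸ 1
    2≤len∸1 e = ℕ.∸-monoˡ-≤ 1 (3≤len e)

    -- `SubAdj` orients each subdivided edge from its first end to its second. Uniqueness of
    -- predecessors and successors bounds internal degrees by two.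
    pred-unique : ∀ {v v′ c} → Adj v (inj₂ c) → Adj v′ (inj₂ c) → v ≡ v′
    pred-unique (first _ _ _) (first _ _ _) = refl
    pred-unique (first _ _ h) (step _ _ _ k) with () ← trans k h
    pred-unique (step _ _ _ h) (first _ _ k) with () ← trans h k
    pred-unique (step e i _ h) (step _ i′ _ k)
      with refl ← toℕ-injective {i = i} {i′} (ℕ.suc-injective (trans h (sym k))) = refl

    succ-unique : ∀ {v v′ c} → Adj (inj₂ c) v → Adj (inj₂ c) v′ → v ≡ v′
    succ-unique (step e i j h) (step _ _ j′ k)
      with refl ← toℕ-injective {i = j} {j′} (trans (sym h) k) = refl
    succ-unique (step _ _ j h) (last _ _ k) = contradiction (trans (sym h) k) (ℕ.<⇒≢ (toℕ<n j))
    succ-unique (last _ _ k) (step _ _ j h) = contradiction (trans (sym h) k) (ℕ.<⇒≢ (toℕ<n j))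
    succ-unique (last _ _ _) (last _ _ _) = refl

    -- A directed triangle through a branch vertex would be a loop subdivided into three edges,
    -- which looplessness excludes.
    cycle₁ : ∀ {p v w} → Adj (inj₁ p) v → Adj v w → ¬ Adj w (inj₁ p)
    cycle₁ {v = inj₂ _} {inj₂ (e , _)} x y z with starts x | steps y | stops z
    ... | refl , _ | refl , _ | h , _ = loopless e h

    cycle : ∀ {u v w} → Adj u v → Adj v w → ¬ Adj w u
    cycle {inj₁ _} x y z = cycle₁ x y z
    cycle {inj₂ _} {inj₁ _} x y z = cycle₁ y z x
    cycle {inj₂ _} {inj₂ _} {inj₁ _} x y z = cycle₁ z x y
    cycle {inj₂ (_ , i)} {inj₂ (_ , j)} {inj₂ (_ , k)} x y z
      with steps x | steps y | steps z
    ... | refl , p | refl , q | _ , r =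
      ℕ.<-asym (ℕ.<-trans (ℕ.≤-reflexive p) (ℕ.≤-reflexive q)) (ℕ.≤-reflexive r)

    -- The other orientation of a triangle, two consecutive arcs and an arc joining their ends:
    -- positions along the subdivided edge do not match.
    shortcut : ∀ {u v w} → Adj u v → Adj v w → ¬ Adj u w
    shortcut {inj₁ _} {inj₂ _} {inj₂ _} x y z with trans (proj₂ (steps y)) (proj₂ (starts z))
    ... | ()
    shortcut {inj₂ _} {inj₁ _} {inj₂ _} x y z with trans (proj₂ (steps z)) (proj₂ (starts y))
    ... | ()
    shortcut {inj₂ _} {inj₂ (_ , j)} {inj₁ _} x y z with steps x
    ... | refl , p = ℕ.<-irrefl
      (ℕ.suc-injective (trans (proj₂ (stops z)) (sym (proj₂ (stops y))))) (ℕ.≤-reflexive p)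
    shortcut {inj₂ _} {inj₂ _} {inj₂ _} x y z with steps x | steps y
    ... | refl , p | refl , q = ℕ.<-irrefl
      (ℕ.suc-injective (trans (proj₂ (steps z)) (sym q))) (ℕ.≤-reflexive p)

  SubE-triangle-free : ∀ {u v w} → SubE M len u v → SubE M len v w → ¬ SubE M len w u
  SubE-triangle-free (inj₁ x) (inj₁ y) (inj₁ z) = cycle x y z
  SubE-triangle-free (inj₁ x) (inj₁ y) (inj₂ z) = shortcut x y z
  SubE-triangle-free (inj₁ x) (inj₂ y) (inj₁ z) = shortcut z x y
  SubE-triangle-free (inj₁ x) (inj₂ y) (inj₂ z) = shortcut z y x
  SubE-triangle-free (inj₂ x) (inj₁ y) (inj₁ z) = shortcut y z x
  SubE-triangle-free (inj₂ x) (inj₁ y) (inj₂ z) = shortcut x z y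
  SubE-triangle-free (inj₂ x) (inj₂ y) (inj₁ z) = shortcut y x z
  SubE-triangle-free (inj₂ x) (inj₂ y) (inj₂ z) = cycle z y x

  SubE-internal-degree : ∀ {s u v w} → SubE M len (inj₂ s) u → SubE M len (inj₂ s) v →
                         SubE M len (inj₂ s) w → u ≡ v ⊎ (u ≡ w ⊎ v ≡ w)
  SubE-internal-degree (inj₁ x) (inj₁ y) _ = inj₁ (succ-unique x y)
  SubE-internal-degree (inj₂ x) (inj₂ y) _ = inj₁ (pred-unique x y)
  SubE-internal-degree (inj₁ x) (inj₂ y) (inj₁ z) = inj₂ (inj₁ (succ-unique x z))
  SubE-internal-degree (inj₁ x) (inj₂ y) (inj₂ z) = inj₂ (inj₂ (pred-unique y z))
  SubE-internal-degree (inj₂ x) (inj₁ y) (inj₁ z) = inj₂ (inj₂ (succ-unique y z))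
  SubE-internal-degree (inj₂ x) (inj₁ y) (inj₂ z) = inj₂ (inj₁ (pred-unique x z))

  SubE-branch-isolated : ∀ {p q} → ¬ SubE M len (inj₁ p) (inj₁ q)
  SubE-branch-isolated (inj₁ ())
  SubE-branch-isolated (inj₂ ())

  private
    -- A vertex both first and last inside its path would leave the path only two edges; here length
    -- at least three enters.
    ¬single : ∀ {e} {i : Fin (len e ∸ 1)} → toℕ i ≡ 0 → suc (toℕ i) ≢ len e ∸ 1
    ¬single {e} p q = ℕ.<⇒≱ (2≤len∸1 e) (ℕ.≤-reflexive (trans (sym q) (cong suc p)))

  SubE-branch-unique : ∀ {p q v} → SubE M len (inj₁ p) v → SubE M len v (inj₁ q) → p ≡ q
  SubE-branch-unique {v = inj₁ _} x _ = contradiction x SubE-branch-isolated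
  SubE-branch-unique {v = inj₂ _} (inj₁ x) (inj₁ y) =
    contradiction (proj₂ (stops y)) (¬single (proj₂ (starts x)))
  SubE-branch-unique {v = inj₂ _} (inj₁ x) (inj₂ y) with refl ← pred-unique x y = refl
  SubE-branch-unique {v = inj₂ _} (inj₂ x) (inj₁ y) with refl ← succ-unique x y = refl
  SubE-branch-unique {v = inj₂ _} (inj₂ x) (inj₂ y) =
    contradiction (proj₂ (stops x)) (¬single (proj₂ (starts y)))

subdivisionLike : ∀ {n} {E : Fin n → Fin n → Set} → IsSimple n E → IsGe2Subdivision n E →
                  SubdivisionLike E
subdivisionLike {n} {E} (E-sym , E-irrefl) (M , len , 3≤len , φ , hφ) = record
  { E-sym = E-sym _ _
  ; E-irrefl = E-irrefl _
  ; triangle-free = λ e f g → SubE-triangle-free (to e) (to f) (to g)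
  ; Branch = λ v → Branch′ (ψ v)
  ; branch? = λ v → branch′? (ψ v)
  ; internal-degree = λ {v} ¬b e f g → internal (ψ v) refl ¬b e f g
  ; branch-isolated = λ {u} {v} → isolated (ψ u) (ψ v) refl refl
  ; branch-unique = λ {u} {v} {w} → unique (ψ u) (ψ w) refl refl }
  where
  open Subdivision M len 3≤len

  ψ = Inverse.to φ

  ψ-injective : ∀ {u v} → ψ u ≡ ψ v → u ≡ v
  ψ-injective {u} {v} p = trans (sym (Inverse.strictlyInverseʳ φ u))
    (trans (cong (Inverse.from φ) p) (Inverse.strictlyInverseʳ φ v))

  to : ∀ {u v} → E u v → SubE M len (ψ u) (ψ v)
  to {u} {v} = Equivalence.to (hφ u v)

  Branch′ : SubV M len → Set
  Branch′ s = ∃[ p ] s ≡ inj₁ p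

  branch′? : ∀ s → Dec (Branch′ s)
  branch′? (inj₁ p) = yes (p , refl)
  branch′? (inj₂ _) = no λ ()

  internal : ∀ {v a b c} s → ψ v ≡ s → ¬ Branch′ s → E v a → E v b → E v c →
             a ≡ b ⊎ (a ≡ c ⊎ b ≡ c)
  internal (inj₁ p) _ ¬b _ _ _ = contradiction (p , refl) ¬b
  internal (inj₂ s) q _ e f g = Sum.map ψ-injective (Sum.map ψ-injective ψ-injective)
    (SubE-internal-degree (at e) (at f) (at g))
    where
    at : ∀ {u} → E _ u → SubE M len (inj₂ s) (ψ u)
    at {u} e = subst (λ t → SubE M len t (ψ u)) q (to e)

  isolated : ∀ {u v} s t → ψ u ≡ s → ψ v ≡ t → Branch′ s → E u v → ¬ Branch′ t
  isolated {u} {v} _ _ p q (_ , refl) e (_ , refl) =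
    SubE-branch-isolated (subst₂ (SubE M len) p q (to e))

  unique : ∀ {u v w} s t → ψ u ≡ s → ψ w ≡ t → Branch′ s → Branch′ t → E u v → E v w → u ≡ w
  unique {v = v} _ _ p q (_ , refl) (_ , refl) e f = ψ-injective (trans p (trans
    (cong inj₁ (SubE-branch-unique (subst (λ t → SubE M len t (ψ v)) p (to e))
                                   (subst (SubE M len (ψ v)) q (to f)))) (sym q)))

theorem5 : (n : ℕ) (E : Fin n → Fin n → Set) →
    IsSimple n E → RestrictedFrameGraph n E → IsGe2Subdivision n E →
    Σ Set λ I → Σ (I → Fin n → Set) λ S →
    AllStable (Fin n) E I S ×
    Constructible (mkGSP (Fin n) E I S)
theorem5 n E simple (F , rep) sub = ⊥ , (λ ()) , (λ ()) , Embedding.induced G S strict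
  where
  G = subdivisionLike simple sub
  repaired = Repair.strictify G (Geometry.nesting G F rep)
  S = proj₁ repaired
  strict = proj₂ repaired
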